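{- For all $n\ge1$, $$I_n(-1,t)=\sum_{\sigma\in\mathrm{Av}_n(321)}(-1)^{\mathrm{inv}\,\sigma}t^{\mathrm{lrm}\,\sigma}=\sum_{k=1}^n(-1)^{n-k}s_{n,k}\,t^k,\qquad s_{n,k}=\binom{\lfloor (n-1)/2\rfloor}{\lfloor (k-1)/2\rfloor}\binom{\lceil (n-1)/2\rceil}{\lceil (k-1)/2\rceil}.$$ Moreover, for all $n\ge1$, $$I_{2n}(-1,t)=(t-1)\,I_{2n-1}(-1,t),$$ $$(n+1)\,I_{2n+1}(-1,t)=2\big((1+t^2)n-t\big)I_{2n-1}(-1,t)-(1-t^2)^2(n-1)\,I_{2n-3}(-1,t),$$ where for $n=1$ the last term is zero because of the factor $n-1$.
   Context: $\mathrm{Av}_n(321)$ is the set of permutations $\sigma=a_1\ldots a_n$ of $[n]$ with no $i<j<k$ such that $a_i>a_j>a_k$. $\mathrm{inv}\,\sigma=\#\{(i,j):i<j,\ a_i>a_j\}$; $\mathrm{lrm}\,\sigma$ is the number of $i$ with $a_i=\max\{a_1,\dots,a_i\}$. $I_n(q,t)=\sum_{\sigma\in\mathrm{Av}_n(321)}q^{\mathrm{inv}\,\sigma}t^{\mathrm{lrm}\,\sigma}$, and $I_n(-1,t)$ is its specialization at $q=-1$. -}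

module Defs where

open import Data.Bool using (Bool; true; false; _∧_; _∨_; not)
open import Data.Nat as ℕ using (ℕ; zero; suc; _∸_; _<ᵇ_; _≤ᵇ_; _≡ᵇ_; ⌊_/2⌋; ⌈_/2⌉)
open import Data.Nat.Combinatorics using (_C_)
open import Data.Integer as ℤ using (ℤ; +_; -1ℤ; 0ℤ; 1ℤ)
open import Data.Fin using (Fin; toℕ)
open import Data.Fin.Base using (Fin)
open import Data.List using (List; []; _∷_; [_]; map; concatMap; filterᵇ; length; foldr; upTo; allFin)
open import Data.Bool.ListAction using (all; any)
open import Data.Vec as Vec using (Vec; lookup)
open import Data.Product using (_×_; _,_)
open import Relation.Binary.PropositionalEquality using (_≡_)

-- Words / permutations of [n]
-- A word a₁…aₙ with letters in [n] is a vector σ : Vec (Fin n) n,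
-- where the letter a_i is (toℕ (lookup σ i)) + 1.  (The shift by one
-- does not affect any comparison, hence none of the statistics.)

allVecs : (n m : ℕ) → List (Vec (Fin n) m)
allVecs n zero    = [ Vec.[] ]
allVecs n (suc m) = concatMap (λ x → map (x Vec.∷_) (allVecs n m)) (allFin n)

val : ∀ {n} → Vec (Fin n) n → Fin n → ℕ
val σ i = toℕ (lookup σ i)

pairs : (n : ℕ) → List (Fin n × Fin n)
pairs n = concatMap (λ i → map (λ j → (i , j)) (filterᵇ (λ j → toℕ i <ᵇ toℕ j) (allFin n))) (allFin n)

triples : (n : ℕ) → List (Fin n × Fin n × Fin n)
triples n = concatMap (λ { (i , j) → map (λ k → (i , j , k)) (filterᵇ (λ k → toℕ j <ᵇ toℕ k) (allFin n)) }) (pairs n)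

isPerm : ∀ {n} → Vec (Fin n) n → Bool
isPerm {n} σ = all (λ { (i , j) → not (val σ i ≡ᵇ val σ j) }) (pairs n)

avoids321 : ∀ {n} → Vec (Fin n) n → Bool
avoids321 {n} σ = not (any (λ { (i , j , k) → (val σ j <ᵇ val σ i) ∧ (val σ k <ᵇ val σ j) }) (triples n))

Av321 : (n : ℕ) → List (Vec (Fin n) n)
Av321 n = filterᵇ (λ σ → isPerm σ ∧ avoids321 σ) (allVecs n n)

inv : ∀ {n} → Vec (Fin n) n → ℕ
inv {n} σ = length (filterᵇ (λ { (i , j) → val σ j <ᵇ val σ i }) (pairs n))

lrm : ∀ {n} → Vec (Fin n) n → ℕ
lrm {n} σ = length (filterᵇ (λ i → all (λ j → (toℕ i <ᵇ toℕ j) ∨ (val σ j ≤ᵇ val σ i)) (allFin n)) (allFin n))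

-- Polynomials in t with integer coefficients, as coefficient functions
-- (p k = coefficient of t^k; all polynomials built here have finite support)

Poly : Set
Poly = ℕ → ℤ

_≈_ : Poly → Poly → Set
p ≈ q = ∀ k → p k ≡ q k
infix 4 _≈_

0p : Poly
0p _ = 0ℤ

mono : ℤ → ℕ → Poly
mono c m k with k ≡ᵇ m
... | true  = c
... | false = 0ℤ

cst : ℤ → Poly
cst c = mono c 0

tt : Poly
tt = mono 1ℤ 1

_⊕_ : Poly → Poly → Poly
(p ⊕ q) k = p k ℤ.+ q k
infixl 6 _⊕_

⊖_ : Poly → Poly
(⊖ p) k = ℤ.- p k

_⊝_ : Poly → Poly → Poly
p ⊝ q = p ⊕ (⊖ q)
infixl 6 _⊝_

sumZ : List ℤ → ℤ
sumZ = foldr ℤ._+_ 0ℤ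

_⊛_ : Poly → Poly → Poly
(p ⊛ q) k = sumZ (map (λ i → p i ℤ.* q (k ∸ i)) (upTo (suc k)))
infixl 7 _⊛_

sumP : List Poly → Poly
sumP = foldr _⊕_ 0p

I-1 : ℕ → Poly
I-1 n = sumP (map (λ σ → mono (-1ℤ ℤ.^ inv σ) (lrm σ)) (Av321 n))

s : ℕ → ℕ → ℕ
s n k = (⌊ n ∸ 1 /2⌋ C ⌊ k ∸ 1 /2⌋) ℕ.* (⌈ n ∸ 1 /2⌉ C ⌈ k ∸ 1 /2⌉)

RHS : ℕ → Poly
RHS n = sumP (map (λ k → mono (-1ℤ ℤ.^ (n ∸ k) ℤ.* + s n k) k) (Data.List.map suc (upTo n)))

{-# OPTIONS --safe #-}
module Submission where

-- Read σ from left to right. Avoiding 321 forces each letter to be either a new maximum or the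
-- least unused value, so the completions of a prefix depend only on the number d of unused
-- values below its maximum and the number r of values above it, and a new maximum creates one
-- inversion per unused value below it. At q = −1 the resulting generating function F(d, r)
-- satisfies
--   F(d, r+1) = F(d−1, r+1) + F(d+1, r) + ((−1)ᵈ t − 1) F(d, r),  F(d, 0) = 1,  F(−1, r) = 0,
-- and is given, according to the parities of d and r, by products or 2 × 2 determinants of
-- binomial coefficients; each case of the induction is Pascal's rule. The closed form of
-- I_n(−1, t) = F(0, n) is the case d = 0, where F(1, 2m+1) = 0 turns the recurrence into the
-- factorisation of I_{2m+2}. The three-term recurrence becomes, coefficientwise, a quadratic
-- identity in consecutive binomial coefficients implied by (k+1) C(n,k+1) = (n−k) C(n,k).

open import Defs
open import Data.Nat using (ℕ; suc; _≤_; _*_; _∸_)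
open import Data.Integer using (+_; 1ℤ; -1ℤ)
open import Data.Product using (_×_)

open import Data.Bool using (Bool; true; false; _∧_; _∨_; not; if_then_else_; T)
open import Data.Bool.ListAction using (all; any; and)
open import Data.Bool.Properties using (T-∧; T?)
open import Data.Fin as Fin using (Fin; toℕ)
import Data.Fin.Properties as Finₚ
open import Data.Integer as ℤ using (ℤ; 0ℤ; -[1+_]; -_)
import Data.Integer.Properties as ℤₚ
open import Data.Integer.Tactic.RingSolver using (solve-∀)
open import Data.List using (List; []; _∷_; _++_; map; concatMap; filterᵇ; length; upTo; applyUpTo; allFin; tabulate; replicate)
import Data.List.Properties as Listₚ
open import Data.List.Membership.Propositional using (_∈_)
open import Data.List.Membership.Propositional.Properties using (∈-++⁺ˡ; ∈-++⁺ʳ; ∈-++⁻; ∈-tabulate⁺)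
open import Data.List.Relation.Unary.All as All using (All; []; _∷_)
import Data.List.Relation.Unary.All.Properties as Allₚ
open import Data.List.Relation.Unary.AllPairs as AllPairs using (AllPairs; []; _∷_)
import Data.List.Relation.Unary.AllPairs.Properties as AllPairsₚ
open import Data.List.Relation.Unary.Any using (here; there)
open import Data.Nat as ℕ using (zero; _<_; _<ᵇ_; _≤ᵇ_; _≡ᵇ_; z≤n; s≤s; _<?_; _≟_; ⌊_/2⌋; ⌈_/2⌉)
import Data.Nat.Properties as ℕₚ
open import Data.Nat.Combinatorics using (_C_; nCk+nC[k+1]≡[n+1]C[k+1]; k>n⇒nCk≡0)
open import Data.Product using (_,_; proj₂; ∃)
open import Data.Sum using (_⊎_; inj₁; inj₂)
open import Data.Unit using (⊤)
open import Data.Vec as Vec using (Vec; lookup)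
open import Function using (_∘_; id; case_of_; Equivalence; mk⇔; _⇔_)
open import Function.Properties.Equivalence using () renaming (trans to ⇔-trans)
open import Relation.Binary.PropositionalEquality
  using (_≡_; _≢_; _≗_; refl; sym; trans; cong; cong₂; subst; subst₂; module ≡-Reasoning)
open import Relation.Nullary using (Dec; yes; no; does; ¬_; contradiction)
open import Relation.Nullary.Decidable using (map′)

-- The definitions test positions of a vector, and a suffix of a permutation is not a permutation of
-- a smaller set, so `Av321` cannot be cut directly at its first letter. Hence every statistic is
-- moved to lists of naturals, the alphabet size n stays fixed, and the sum runs over all vectors,
-- with weight zero for those that are not completions; then `allVecs` itself splits by first
-- letter. What q = -1 buys is that the sign depends on d only through its parity, and that one
-- parity class, d and r both odd, vanishes identically. That vanishing removes a term from the
-- recurrence in each of the other three classes and keeps their closed forms short. The three-term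
-- recurrence is not derived from the recurrence of F but checked on the closed form: Pascal's rule
-- brings rows n and n - 1 down to row n - 2, where the defect is a linear combination of two
-- expressions that vanish by the absorption rule for binomial coefficients.

private variable
  A B : Set

-- Statistics of a permutation as statistics of its list of letters

pairsOf : List A → List (A × A)
pairsOf []       = []
pairsOf (x ∷ xs) = map (x ,_) xs ++ pairsOf xs

triplesOf : List A → List (A × A × A)
triplesOf []       = []
triplesOf (x ∷ xs) = map (x ,_) (pairsOf xs) ++ triplesOf xs

private
  map₂ : (A → B) → A × A → B × B
  map₂ f (x , y) = f x , f y

  map₃ : (A → B) → A × A × A → B × B × B
  map₃ f (x , y , z) = f x , f y , f z

filterᵇ-map : (p : B → Bool) (f : A → B) (xs : List A) →
              filterᵇ p (map f xs) ≡ map f (filterᵇ (p ∘ f) xs)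
filterᵇ-map p f []       = refl
filterᵇ-map p f (x ∷ xs) with p (f x)
... | true  = cong (f x ∷_) (filterᵇ-map p f xs)
... | false = filterᵇ-map p f xs

filterᵇ-true : (xs : List A) → filterᵇ (λ _ → true) xs ≡ xs
filterᵇ-true []       = refl
filterᵇ-true (x ∷ xs) = cong (x ∷_) (filterᵇ-true xs)

filterᵇ-cong : {p q : A → Bool} → p ≗ q → filterᵇ p ≗ filterᵇ q
filterᵇ-cong         p≗q []       = refl
filterᵇ-cong {q = q} p≗q (x ∷ xs) rewrite p≗q x with q x
... | true  = cong (x ∷_) (filterᵇ-cong p≗q xs)
... | false = filterᵇ-cong p≗q xs

-- The test for later indices is vacuous at index zero and invariant under `Fin.suc`, so the index
-- pairs follow the same recursion as `pairsOf`: the head with everything after it, then the pairs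
-- of the tail.
pairs-suc : ∀ n → pairs (suc n) ≡
            map (Fin.zero ,_) (map Fin.suc (allFin n)) ++ map (map₂ Fin.suc) (pairs n)
pairs-suc n = cong₂ _++_ (cong (map (Fin.zero ,_)) row₀) rows
  where
  open ≡-Reasoning
  row : ∀ {n} → Fin n → List (Fin n × Fin n)
  row {n} i = map (i ,_) (filterᵇ (λ j → toℕ i <ᵇ toℕ j) (allFin n))

  row₀ : filterᵇ (λ j → 0 <ᵇ toℕ j) (allFin (suc n)) ≡ map Fin.suc (allFin n)
  row₀ = begin
    filterᵇ (λ j → 0 <ᵇ toℕ j) (tabulate Fin.suc)
      ≡⟨ cong (filterᵇ _) (Listₚ.map-tabulate id Fin.suc) ⟨
    filterᵇ (λ j → 0 <ᵇ toℕ j) (map Fin.suc (allFin n))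
      ≡⟨ filterᵇ-map _ Fin.suc (allFin n) ⟩
    map Fin.suc (filterᵇ (λ _ → true) (allFin n))
      ≡⟨ cong (map Fin.suc) (filterᵇ-true (allFin n)) ⟩
    map Fin.suc (allFin n) ∎

  row-suc : ∀ i → row (Fin.suc i) ≡ map (map₂ Fin.suc) (row i)
  row-suc i = begin
    map (Fin.suc i ,_) (filterᵇ (λ j → toℕ (Fin.suc i) <ᵇ toℕ j) (tabulate Fin.suc))
      ≡⟨ cong (λ js → map (Fin.suc i ,_) (filterᵇ (λ j → toℕ (Fin.suc i) <ᵇ toℕ j) js)) (Listₚ.map-tabulate id Fin.suc) ⟨
    map (Fin.suc i ,_) (filterᵇ (λ j → toℕ (Fin.suc i) <ᵇ toℕ j) (map Fin.suc (allFin n)))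
      ≡⟨ cong (map (Fin.suc i ,_)) (filterᵇ-map _ Fin.suc (allFin n)) ⟩
    map (Fin.suc i ,_) (map Fin.suc (filterᵇ (λ j → toℕ i <ᵇ toℕ j) (allFin n)))
      ≡⟨ Listₚ.map-∘ _ ⟨
    map (λ j → Fin.suc i , Fin.suc j) (filterᵇ (λ j → toℕ i <ᵇ toℕ j) (allFin n))
      ≡⟨ Listₚ.map-∘ _ ⟩
    map (map₂ Fin.suc) (row i) ∎

  rows : concatMap row (tabulate Fin.suc) ≡ map (map₂ Fin.suc) (pairs n)
  rows = begin
    concatMap row (tabulate Fin.suc)
      ≡⟨ cong (concatMap row) (Listₚ.map-tabulate id Fin.suc) ⟨
    concatMap row (map Fin.suc (allFin n))
      ≡⟨ Listₚ.concatMap-map row Fin.suc (allFin n) ⟩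
    concatMap (row ∘ Fin.suc) (allFin n)
      ≡⟨ Listₚ.concatMap-cong row-suc (allFin n) ⟩
    concatMap (map (map₂ Fin.suc) ∘ row) (allFin n)
      ≡⟨ Listₚ.map-concatMap (map₂ Fin.suc) row (allFin n) ⟨
    map (map₂ Fin.suc) (pairs n) ∎

-- Names the anonymous function inside `triples`, so that rewriting under `concatMap` has a term to
-- refer to.
extensions : ∀ {n} → Fin n × Fin n → List (Fin n × Fin n × Fin n)
extensions {n} (i , j) = map (λ k → i , j , k) (filterᵇ (λ k → toℕ j <ᵇ toℕ k) (allFin n))

triples-extensions : ∀ n → triples n ≡ concatMap extensions (pairs n)
triples-extensions n = Listₚ.concatMap-cong (λ _ → refl) (pairs n)

extensions-suc : ∀ {n} (i : Fin (suc n)) (j : Fin n) →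
  extensions (i , Fin.suc j) ≡
  map (λ k → i , Fin.suc j , Fin.suc k) (filterᵇ (λ k → toℕ j <ᵇ toℕ k) (allFin n))
extensions-suc {n} i j = begin
  map (λ k → i , Fin.suc j , k) (filterᵇ (λ k → toℕ (Fin.suc j) <ᵇ toℕ k) (tabulate Fin.suc))
    ≡⟨ cong (λ ks → map (λ k → i , Fin.suc j , k) (filterᵇ (λ k → toℕ (Fin.suc j) <ᵇ toℕ k) ks)) (Listₚ.map-tabulate id Fin.suc) ⟨
  map (λ k → i , Fin.suc j , k) (filterᵇ (λ k → toℕ (Fin.suc j) <ᵇ toℕ k) (map Fin.suc (allFin n)))
    ≡⟨ cong (map (λ k → i , Fin.suc j , k)) (filterᵇ-map _ Fin.suc (allFin n)) ⟩
  map (λ k → i , Fin.suc j , k) (map Fin.suc (filterᵇ (λ k → toℕ j <ᵇ toℕ k) (allFin n)))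
    ≡⟨ Listₚ.map-∘ _ ⟨
  map (λ k → i , Fin.suc j , Fin.suc k) (filterᵇ (λ k → toℕ j <ᵇ toℕ k) (allFin n)) ∎
  where open ≡-Reasoning

triples-suc : ∀ n → triples (suc n) ≡
              map (Fin.zero ,_) (map (map₂ Fin.suc) (pairs n)) ++ map (map₃ Fin.suc) (triples n)
triples-suc n = begin
  triples (suc n)
    ≡⟨ triples-extensions (suc n) ⟩
  concatMap extensions (pairs (suc n))
    ≡⟨ cong (concatMap extensions) (pairs-suc n) ⟩
  concatMap extensions (map (Fin.zero ,_) (map Fin.suc (allFin n)) ++ map (map₂ Fin.suc) (pairs n))
    ≡⟨ Listₚ.concatMap-++ extensions (map (Fin.zero ,_) (map Fin.suc (allFin n))) _ ⟩
  concatMap extensions (map (Fin.zero ,_) (map Fin.suc (allFin n))) ++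
  concatMap extensions (map (map₂ Fin.suc) (pairs n))
    ≡⟨ cong₂ _++_ first rest ⟩
  map (Fin.zero ,_) (map (map₂ Fin.suc) (pairs n)) ++ map (map₃ Fin.suc) (triples n) ∎
  where
  open ≡-Reasoning

  first : concatMap extensions (map (Fin.zero ,_) (map Fin.suc (allFin n))) ≡
          map (Fin.zero ,_) (map (map₂ Fin.suc) (pairs n))
  first = begin
    concatMap extensions (map (Fin.zero ,_) (map Fin.suc (allFin n)))
      ≡⟨ cong (concatMap extensions) (Listₚ.map-∘ (allFin n)) ⟨
    concatMap extensions (map (λ j → Fin.zero , Fin.suc j) (allFin n))
      ≡⟨ Listₚ.concatMap-map extensions _ (allFin n) ⟩
    concatMap (λ j → extensions (Fin.zero , Fin.suc j)) (allFin n)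
      ≡⟨ Listₚ.concatMap-cong (λ j → trans (extensions-suc Fin.zero j) (Listₚ.map-∘ _)) (allFin n) ⟩
    concatMap (λ j → map (λ p → Fin.zero , map₂ Fin.suc p) (map (j ,_) (filterᵇ (λ k → toℕ j <ᵇ toℕ k) (allFin n)))) (allFin n)
      ≡⟨ Listₚ.map-concatMap _ _ (allFin n) ⟨
    map (λ p → Fin.zero , map₂ Fin.suc p) (pairs n)
      ≡⟨ Listₚ.map-∘ (pairs n) ⟩
    map (Fin.zero ,_) (map (map₂ Fin.suc) (pairs n)) ∎

  rest : concatMap extensions (map (map₂ Fin.suc) (pairs n)) ≡ map (map₃ Fin.suc) (triples n)
  rest = begin
    concatMap extensions (map (map₂ Fin.suc) (pairs n))
      ≡⟨ Listₚ.concatMap-map extensions (map₂ Fin.suc) (pairs n) ⟩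
    concatMap (extensions ∘ map₂ Fin.suc) (pairs n)
      ≡⟨ Listₚ.concatMap-cong (λ { (i , j) → trans (extensions-suc (Fin.suc i) j) (Listₚ.map-∘ _) }) (pairs n) ⟩
    concatMap (map (map₃ Fin.suc) ∘ extensions) (pairs n)
      ≡⟨ Listₚ.map-concatMap (map₃ Fin.suc) extensions (pairs n) ⟨
    map (map₃ Fin.suc) (concatMap extensions (pairs n))
      ≡⟨ cong (map (map₃ Fin.suc)) (triples-extensions n) ⟨
    map (map₃ Fin.suc) (triples n) ∎

map-pairs : ∀ {n} (f : Fin n → A) → map (map₂ f) (pairs n) ≡ pairsOf (tabulate f)
map-pairs {n = zero}  f = refl
map-pairs {n = suc n} f = begin
  map (map₂ f) (pairs (suc n))
    ≡⟨ cong (map (map₂ f)) (pairs-suc n) ⟩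
  map (map₂ f) (map (Fin.zero ,_) (map Fin.suc (allFin n)) ++ map (map₂ Fin.suc) (pairs n))
    ≡⟨ Listₚ.map-++ (map₂ f) _ (map (map₂ Fin.suc) (pairs n)) ⟩
  map (map₂ f) (map (Fin.zero ,_) (map Fin.suc (allFin n))) ++ map (map₂ f) (map (map₂ Fin.suc) (pairs n))
    ≡⟨ cong₂ _++_ first (trans (sym (Listₚ.map-∘ (pairs n))) (map-pairs (f ∘ Fin.suc))) ⟩
  pairsOf (tabulate f) ∎
  where
  open ≡-Reasoning
  first : map (map₂ f) (map (Fin.zero ,_) (map Fin.suc (allFin n))) ≡
          map (f Fin.zero ,_) (tabulate (f ∘ Fin.suc))
  first = begin
    map (map₂ f) (map (Fin.zero ,_) (map Fin.suc (allFin n)))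
      ≡⟨ Listₚ.map-∘ (map Fin.suc (allFin n)) ⟨
    map (λ j → f Fin.zero , f j) (map Fin.suc (allFin n))
      ≡⟨ Listₚ.map-∘ (allFin n) ⟨
    map (λ j → f Fin.zero , f (Fin.suc j)) (allFin n)
      ≡⟨ Listₚ.map-tabulate id _ ⟩
    tabulate (λ j → f Fin.zero , f (Fin.suc j))
      ≡⟨ Listₚ.map-tabulate (f ∘ Fin.suc) (f Fin.zero ,_) ⟨
    map (f Fin.zero ,_) (tabulate (f ∘ Fin.suc)) ∎

map-triples : ∀ {n} (f : Fin n → A) → map (map₃ f) (triples n) ≡ triplesOf (tabulate f)
map-triples {n = zero}  f = refl
map-triples {n = suc n} f = begin
  map (map₃ f) (triples (suc n))
    ≡⟨ cong (map (map₃ f)) (triples-suc n) ⟩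
  map (map₃ f) (map (Fin.zero ,_) (map (map₂ Fin.suc) (pairs n)) ++ map (map₃ Fin.suc) (triples n))
    ≡⟨ Listₚ.map-++ (map₃ f) _ (map (map₃ Fin.suc) (triples n)) ⟩
  map (map₃ f) (map (Fin.zero ,_) (map (map₂ Fin.suc) (pairs n))) ++ map (map₃ f) (map (map₃ Fin.suc) (triples n))
    ≡⟨ cong₂ _++_ first (trans (sym (Listₚ.map-∘ (triples n))) (map-triples (f ∘ Fin.suc))) ⟩
  triplesOf (tabulate f) ∎
  where
  open ≡-Reasoning
  first : map (map₃ f) (map (Fin.zero ,_) (map (map₂ Fin.suc) (pairs n))) ≡
          map (f Fin.zero ,_) (pairsOf (tabulate (f ∘ Fin.suc)))
  first = begin
    map (map₃ f) (map (Fin.zero ,_) (map (map₂ Fin.suc) (pairs n)))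
      ≡⟨ Listₚ.map-∘ (map (map₂ Fin.suc) (pairs n)) ⟨
    map (λ p → f Fin.zero , map₂ f p) (map (map₂ Fin.suc) (pairs n))
      ≡⟨ Listₚ.map-∘ (pairs n) ⟨
    map (λ p → f Fin.zero , map₂ (f ∘ Fin.suc) p) (pairs n)
      ≡⟨ Listₚ.map-∘ (pairs n) ⟩
    map (f Fin.zero ,_) (map (map₂ (f ∘ Fin.suc)) (pairs n))
      ≡⟨ cong (map (f Fin.zero ,_)) (map-pairs (f ∘ Fin.suc)) ⟩
    map (f Fin.zero ,_) (pairsOf (tabulate (f ∘ Fin.suc))) ∎

-- Inversions, records and 321-avoidance of words

word : ∀ {n m} → Vec (Fin n) m → List ℕ
word σ = tabulate (toℕ ∘ lookup σ)

countBelow : ℕ → List ℕ → ℕ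
countBelow b w = length (filterᵇ (_<ᵇ b) w)

inversions : List ℕ → ℕ
inversions []      = 0
inversions (x ∷ w) = countBelow x w ℕ.+ inversions w

-- The number of left-to-right maxima of w that are at least h.
recordsFrom : ℕ → List ℕ → ℕ
recordsFrom h []      = 0
recordsFrom h (x ∷ w) = if h ≤ᵇ x then suc (recordsFrom x w) else recordsFrom h w

-- When the letter `b` precedes the list, a violation is a 321 pattern headed by `b`. Only `y` is
-- compared with `b`, because z < y < b puts the third letter below `b` as well.
IncreasingBelow : ℕ → List ℕ → Set
IncreasingBelow b = AllPairs (λ y z → y < b → y ≤ z)

Avoids321 : List ℕ → Set
Avoids321 []      = ⊤
Avoids321 (x ∷ w) = IncreasingBelow x w × Avoids321 w

length-filterᵇ-map : {p : A → Bool} {q : B → Bool} (g : A → B) → (∀ x → p x ≡ q (g x)) →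
                     ∀ xs → length (filterᵇ p xs) ≡ length (filterᵇ q (map g xs))
length-filterᵇ-map {q = q} g eq xs = begin
  length (filterᵇ _ xs)               ≡⟨ cong length (filterᵇ-cong eq xs) ⟩
  length (filterᵇ (q ∘ g) xs)         ≡⟨ Listₚ.length-map g (filterᵇ (q ∘ g) xs) ⟨
  length (map g (filterᵇ (q ∘ g) xs)) ≡⟨ cong length (filterᵇ-map q g xs) ⟨
  length (filterᵇ q (map g xs))       ∎
  where open ≡-Reasoning

all-map : {p : A → Bool} {q : B → Bool} (g : A → B) → (∀ x → p x ≡ q (g x)) →
          ∀ xs → all p xs ≡ all q (map g xs)
all-map g eq xs = cong and (trans (Listₚ.map-cong eq xs) (Listₚ.map-∘ xs))

not-any : {p : A → Bool} {q : A → Bool} → (∀ x → not (p x) ≡ q x) →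
          ∀ xs → not (any p xs) ≡ all q xs
not-any         eq []       = refl
not-any {p = p} eq (x ∷ xs) rewrite sym (eq x) with p x
... | true  = refl
... | false = not-any eq xs

filterᵇ-++ : (p : A → Bool) (xs ys : List A) → filterᵇ p (xs ++ ys) ≡ filterᵇ p xs ++ filterᵇ p ys
filterᵇ-++ p = Listₚ.filter-++ (T? ∘ p)

inversions-pairsOf : ∀ w → length (filterᵇ (λ (x , y) → y <ᵇ x) (pairsOf w)) ≡ inversions w
inversions-pairsOf []      = refl
inversions-pairsOf (x ∷ w) = begin
  length (filterᵇ invᵇ (map (x ,_) w ++ pairsOf w))
    ≡⟨ cong length (filterᵇ-++ invᵇ (map (x ,_) w) (pairsOf w)) ⟩
  length (filterᵇ invᵇ (map (x ,_) w) ++ filterᵇ invᵇ (pairsOf w))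
    ≡⟨ Listₚ.length-++ (filterᵇ invᵇ (map (x ,_) w)) ⟩
  length (filterᵇ invᵇ (map (x ,_) w)) ℕ.+ length (filterᵇ invᵇ (pairsOf w))
    ≡⟨ cong₂ ℕ._+_ (sym (length-filterᵇ-map (x ,_) (λ _ → refl) w)) (inversions-pairsOf w) ⟩
  countBelow x w ℕ.+ inversions w ∎
  where
  open ≡-Reasoning
  invᵇ : ℕ × ℕ → Bool
  invᵇ (x , y) = y <ᵇ x

inv-word : ∀ {n} (σ : Vec (Fin n) n) → inv σ ≡ inversions (word σ)
inv-word {n} σ = begin
  inv σ
    ≡⟨ length-filterᵇ-map (map₂ (val σ)) (λ _ → refl) (pairs n) ⟩
  length (filterᵇ (λ (x , y) → y <ᵇ x) (map (map₂ (val σ)) (pairs n)))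
    ≡⟨ cong (length ∘ filterᵇ _) (map-pairs (val σ)) ⟩
  length (filterᵇ (λ (x , y) → y <ᵇ x) (pairsOf (word σ)))
    ≡⟨ inversions-pairsOf (word σ) ⟩
  inversions (word σ) ∎
  where open ≡-Reasoning

-- The test inside `lrm` for an arbitrary value function, so that passing to a suffix is composition
-- with `Fin.suc`.
isRecord : ∀ {m} → (Fin m → ℕ) → Fin m → Bool
isRecord {m} f i = all (λ j → (toℕ i <ᵇ toℕ j) ∨ (f j ≤ᵇ f i)) (allFin m)

≤ᵇ-true : ∀ {x y} → x ≤ y → (x ≤ᵇ y) ≡ true
≤ᵇ-true {x} {y} x≤y with x ≤ᵇ y | ℕₚ.≤⇒≤ᵇ x≤y
... | true | _ = refl

≤ᵇ-false : ∀ {x y} → y < x → (x ≤ᵇ y) ≡ false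
≤ᵇ-false {x} {y} y<x with x ≤ᵇ y in eq
... | false = refl
... | true  = contradiction (ℕₚ.≤ᵇ⇒≤ x y (subst T (sym eq) _)) (ℕₚ.<⇒≱ y<x)

all-true : {p : A → Bool} → (∀ x → p x ≡ true) → ∀ xs → all p xs ≡ true
all-true eq []       = refl
all-true eq (x ∷ xs) rewrite eq x = all-true eq xs

isRecord-zero : ∀ {m} (f : Fin (suc m) → ℕ) → isRecord f Fin.zero ≡ true
isRecord-zero {m} f rewrite ≤ᵇ-true (ℕₚ.≤-refl {f Fin.zero}) = begin
  all (λ j → (0 <ᵇ toℕ j) ∨ (f j ≤ᵇ f Fin.zero)) (tabulate Fin.suc)
    ≡⟨ cong (all (λ j → (0 <ᵇ toℕ j) ∨ (f j ≤ᵇ f Fin.zero))) (Listₚ.map-tabulate id Fin.suc) ⟨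
  all (λ j → (0 <ᵇ toℕ j) ∨ (f j ≤ᵇ f Fin.zero)) (map Fin.suc (allFin m))
    ≡⟨ all-map Fin.suc (λ _ → refl) (allFin m) ⟨
  all (λ _ → true) (allFin m)
    ≡⟨ all-true (λ _ → refl) (allFin m) ⟩
  true ∎
  where open ≡-Reasoning

isRecord-suc : ∀ {m} (f : Fin (suc m) → ℕ) i →
               isRecord f (Fin.suc i) ≡ (f Fin.zero ≤ᵇ f (Fin.suc i)) ∧ isRecord (f ∘ Fin.suc) i
isRecord-suc {m} f i = cong ((f Fin.zero ≤ᵇ f (Fin.suc i)) ∧_) (begin
  all (λ j → (toℕ (Fin.suc i) <ᵇ toℕ j) ∨ (f j ≤ᵇ f (Fin.suc i))) (tabulate Fin.suc)
    ≡⟨ cong (all (λ j → (toℕ (Fin.suc i) <ᵇ toℕ j) ∨ (f j ≤ᵇ f (Fin.suc i)))) (Listₚ.map-tabulate id Fin.suc) ⟨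
  all (λ j → (toℕ (Fin.suc i) <ᵇ toℕ j) ∨ (f j ≤ᵇ f (Fin.suc i))) (map Fin.suc (allFin m))
    ≡⟨ all-map Fin.suc (λ _ → refl) (allFin m) ⟨
  isRecord (f ∘ Fin.suc) i ∎)
  where open ≡-Reasoning

filterᵇ-∷ : (p : A → Bool) (x : A) (xs : List A) →
            length (filterᵇ p (x ∷ xs)) ≡ (if p x then 1 else 0) ℕ.+ length (filterᵇ p xs)
filterᵇ-∷ p x xs with p x
... | true  = refl
... | false = refl

-- The threshold `h` remembers the maximum of the letters already removed; without it the suffix
-- does not determine which of its letters are records. Removing the head adds the test against
-- `f Fin.zero`, and the larger of the two thresholds absorbs the other, as in the two branches of
-- `recordsFrom`.
recordsFrom-tabulate : ∀ {m} h (f : Fin m → ℕ) →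
  length (filterᵇ (λ i → (h ≤ᵇ f i) ∧ isRecord f i) (allFin m)) ≡ recordsFrom h (tabulate f)
recordsFrom-tabulate {zero}  h f = refl
recordsFrom-tabulate {suc m} h f = begin
  length (filterᵇ P (allFin (suc m)))
    ≡⟨ filterᵇ-∷ P Fin.zero (tabulate Fin.suc) ⟩
  (if P Fin.zero then 1 else 0) ℕ.+ length (filterᵇ P (tabulate Fin.suc))
    ≡⟨ cong₂ ℕ._+_ (cong (λ b → if (h ≤ᵇ f Fin.zero) ∧ b then 1 else 0) (isRecord-zero f)) rest ⟩
  (if (h ≤ᵇ f Fin.zero) ∧ true then 1 else 0) ℕ.+
    length (filterᵇ (λ i → (h ≤ᵇ f (Fin.suc i)) ∧ (f Fin.zero ≤ᵇ f (Fin.suc i)) ∧ isRecord g i) (allFin m))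
    ≡⟨ split ⟩
  recordsFrom h (tabulate f) ∎
  where
  open ≡-Reasoning
  g = f ∘ Fin.suc
  P : Fin (suc m) → Bool
  P i = (h ≤ᵇ f i) ∧ isRecord f i
  rest : length (filterᵇ P (tabulate Fin.suc)) ≡
         length (filterᵇ (λ i → (h ≤ᵇ f (Fin.suc i)) ∧ (f Fin.zero ≤ᵇ f (Fin.suc i)) ∧ isRecord g i) (allFin m))
  rest = begin
    length (filterᵇ P (tabulate Fin.suc))
      ≡⟨ cong (length ∘ filterᵇ P) (Listₚ.map-tabulate id Fin.suc) ⟨
    length (filterᵇ P (map Fin.suc (allFin m)))
      ≡⟨ length-filterᵇ-map Fin.suc (λ i → cong ((h ≤ᵇ f (Fin.suc i)) ∧_) (sym (isRecord-suc f i))) (allFin m) ⟨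
    length (filterᵇ (λ i → (h ≤ᵇ f (Fin.suc i)) ∧ (f Fin.zero ≤ᵇ f (Fin.suc i)) ∧ isRecord g i) (allFin m)) ∎
  ≤ᵇ-absorb : ∀ {x y} z b → x ≤ y → (x ≤ᵇ z) ∧ (y ≤ᵇ z) ∧ b ≡ (y ≤ᵇ z) ∧ b
  ≤ᵇ-absorb {x} {y} z b x≤y with y ℕ.≤? z
  ... | yes y≤z rewrite ≤ᵇ-true (ℕₚ.≤-trans x≤y y≤z) = refl
  ... | no  y≰z rewrite ≤ᵇ-false (ℕₚ.≰⇒> y≰z) with x ≤ᵇ z
  ...   | true  = refl
  ...   | false = refl
  ≤ᵇ-absorb′ : ∀ {x y} z b → y < x → (x ≤ᵇ z) ∧ (y ≤ᵇ z) ∧ b ≡ (x ≤ᵇ z) ∧ b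
  ≤ᵇ-absorb′ {x} {y} z b y<x with x ℕ.≤? z
  ... | yes x≤z rewrite ≤ᵇ-true x≤z | ≤ᵇ-true (ℕₚ.≤-trans (ℕₚ.<⇒≤ y<x) x≤z) = refl
  ... | no  x≰z rewrite ≤ᵇ-false (ℕₚ.≰⇒> x≰z) = refl
  split : (if (h ≤ᵇ f Fin.zero) ∧ true then 1 else 0) ℕ.+
    length (filterᵇ (λ i → (h ≤ᵇ f (Fin.suc i)) ∧ (f Fin.zero ≤ᵇ f (Fin.suc i)) ∧ isRecord g i) (allFin m))
    ≡ recordsFrom h (tabulate f)
  split with h ℕ.≤? f Fin.zero
  ... | yes h≤f rewrite ≤ᵇ-true h≤f = cong suc (trans
          (cong length (filterᵇ-cong (λ i → ≤ᵇ-absorb (g i) (isRecord g i) h≤f) (allFin m)))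
          (recordsFrom-tabulate (f Fin.zero) g))
  ... | no  h≰f rewrite ≤ᵇ-false (ℕₚ.≰⇒> h≰f) = trans
          (cong length (filterᵇ-cong (λ i → ≤ᵇ-absorb′ (g i) (isRecord g i) (ℕₚ.≰⇒> h≰f)) (allFin m)))
          (recordsFrom-tabulate h g)

lrm-word : ∀ {n} (σ : Vec (Fin n) n) → lrm σ ≡ recordsFrom 0 (word σ)
lrm-word σ = recordsFrom-tabulate 0 (val σ)

T-not : ∀ {b} → T (not b) ⇔ (¬ T b)
T-not {true}  = mk⇔ (λ ()) (λ ¬t → ¬t _)
T-not {false} = mk⇔ (λ _ ()) _

All-pairsOf : {R : A → A → Set} (xs : List A) → All (λ (x , y) → R x y) (pairsOf xs) ⇔ AllPairs R xs
All-pairsOf []       = mk⇔ (λ _ → []) (λ _ → [])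
All-pairsOf (x ∷ xs) = mk⇔
  (λ ps → let qs , rs = Allₚ.++⁻ (map (x ,_) xs) ps in Allₚ.map⁻ qs ∷ Equivalence.to (All-pairsOf xs) rs)
  (λ { (qs ∷ rs) → Allₚ.++⁺ (Allₚ.map⁺ qs) (Equivalence.from (All-pairsOf xs) rs) })

All-triplesOf : (w : List ℕ) → All (λ (x , y , z) → y < x → y ≤ z) (triplesOf w) ⇔ Avoids321 w
All-triplesOf []      = mk⇔ _ (λ _ → [])
All-triplesOf (x ∷ w) = mk⇔
  (λ ps → let qs , rs = Allₚ.++⁻ (map (x ,_) (pairsOf w)) ps in
    Equivalence.to (All-pairsOf w) (Allₚ.map⁻ qs) , Equivalence.to (All-triplesOf w) rs)
  (λ { (qs , rs) → Allₚ.++⁺ (Allₚ.map⁺ (Equivalence.from (All-pairsOf w) qs)) (Equivalence.from (All-triplesOf w) rs) })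

T-all : {p : A → Bool} {P : A → Set} → (∀ x → T (p x) ⇔ P x) → ∀ xs → T (all p xs) ⇔ All P xs
T-all {p = p} eq xs = mk⇔
  (λ t → All.map (λ {x} → Equivalence.to (eq x)) (Allₚ.all⁺ p xs t))
  (λ ps → Allₚ.all⁻ p (All.map (λ {x} → Equivalence.from (eq x)) ps))

isPerm-word : ∀ {n} (σ : Vec (Fin n) n) → T (isPerm σ) ⇔ AllPairs _≢_ (word σ)
isPerm-word {n} σ = subst (λ b → T b ⇔ AllPairs _≢_ (word σ)) (sym eq)
  (⇔-trans (T-all (λ (x , y) → distinct x y) (pairsOf (word σ))) (All-pairsOf (word σ)))
  where
  eq : isPerm σ ≡ all (λ (x , y) → not (x ≡ᵇ y)) (pairsOf (word σ))
  eq = trans (all-map (map₂ (val σ)) (λ _ → refl) (pairs n)) (cong (all _) (map-pairs (val σ)))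
  distinct : ∀ x y → T (not (x ≡ᵇ y)) ⇔ x ≢ y
  distinct x y = mk⇔
    (λ t x≡y → Equivalence.to T-not t (ℕₚ.≡⇒≡ᵇ x y x≡y))
    (λ x≢y → Equivalence.from T-not (x≢y ∘ ℕₚ.≡ᵇ⇒≡ x y))

avoids321-word : ∀ {n} (σ : Vec (Fin n) n) → T (avoids321 σ) ⇔ Avoids321 (word σ)
avoids321-word {n} σ = subst (λ b → T b ⇔ Avoids321 (word σ)) (sym eq)
  (⇔-trans (T-all (λ (x , y , z) → noDescent x y z) (triplesOf (word σ))) (All-triplesOf (word σ)))
  where
  eq : avoids321 σ ≡ all (λ (x , y , z) → not ((y <ᵇ x) ∧ (z <ᵇ y))) (triplesOf (word σ))
  eq = trans (not-any (λ _ → refl) (triples n))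
         (trans (all-map (map₃ (val σ)) (λ _ → refl) (triples n)) (cong (all _) (map-triples (val σ))))
  noDescent : ∀ x y z → T (not ((y <ᵇ x) ∧ (z <ᵇ y))) ⇔ (y < x → y ≤ z)
  noDescent x y z = mk⇔
    (λ t y<x → ℕₚ.≮⇒≥ (λ z<y → Equivalence.to T-not t
      (Equivalence.from T-∧ (ℕₚ.<⇒<ᵇ y<x , ℕₚ.<⇒<ᵇ z<y))))
    (λ f → Equivalence.from T-not (λ t → let p , q = Equivalence.to T-∧ t in
      ℕₚ.<⇒≱ (ℕₚ.<ᵇ⇒< z y q) (f (ℕₚ.<ᵇ⇒< y x p))))

-- Completions of a prefix

range : ℕ → ℕ → List ℕ
range h zero    = []
range h (suc j) = h ∷ range (suc h) j

range-≥ : ∀ h j → All (h ≤_) (range h j)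
range-≥ h zero    = []
range-≥ h (suc j) = ℕₚ.≤-refl ∷ All.map ℕₚ.<⇒≤ (range-≥ (suc h) j)

range-< : ∀ h j → All (_< h ℕ.+ j) (range h j)
range-< h zero    = []
range-< h (suc j) rewrite ℕₚ.+-suc h j = s≤s (ℕₚ.m≤m+n h j) ∷ range-< (suc h) j

range-increasing : ∀ h j → AllPairs _<_ (range h j)
range-increasing h zero    = []
range-increasing h (suc j) = range-≥ (suc h) j ∷ range-increasing (suc h) j

∈-range : ∀ {y} h j → h ≤ y → y < h ℕ.+ j → y ∈ range h j
∈-range {y} h zero    h≤y y<h = contradiction (subst (y <_) (ℕₚ.+-identityʳ h) y<h) (ℕₚ.≤⇒≯ h≤y)
∈-range {y} h (suc j) h≤y y<h with h ≟ y
... | yes refl = here refl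
... | no  h≢y  = there (∈-range (suc h) j (ℕₚ.≤∧≢⇒< h≤y h≢y) (subst (y <_) (ℕₚ.+-suc h j) y<h))

length-range : ∀ h j → length (range h j) ≡ j
length-range h zero    = refl
length-range h (suc j) = cong suc (length-range (suc h) j)

-- Walk L h w: w can follow a prefix whose maximum is h − 1 and whose unused values below h
-- are L, in increasing order.
data Walk (L : List ℕ) (h : ℕ) : List ℕ → Set where
  done : Walk L h []
  rise : ∀ j {w} → Walk (L ++ range h j) (suc (h ℕ.+ j)) w → Walk L h (h ℕ.+ j ∷ w)
  fall : ∀ {x L′ w} → L ≡ x ∷ L′ → x < h → Walk L′ h w → Walk L h (x ∷ w)

walk-fall : ∀ {L h x w} → x < h → Walk L h (x ∷ w) → ∃ λ L′ → L ≡ x ∷ L′ × Walk L′ h w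
walk-fall {h = h} x<h (rise j p)     = contradiction x<h (ℕₚ.≤⇒≯ (ℕₚ.m≤m+n h j))
walk-fall         x<h (fall eq _ p) = _ , eq , p

walk-rise : ∀ {L h w} j → Walk L h (h ℕ.+ j ∷ w) → Walk (L ++ range h j) (suc (h ℕ.+ j)) w
walk-rise {L} {h} {w} j p = go refl p
  where
  -- The letter `h ℕ.+ j` cannot be unified with the index of `rise`, so it is replaced by a
  -- variable and an equation, from which cancellation recovers the number of skipped values.
  go : ∀ {x} → x ≡ h ℕ.+ j → Walk L h (x ∷ w) → Walk (L ++ range h j) (suc (h ℕ.+ j)) w
  go eq (rise i p) rewrite ℕₚ.+-cancelˡ-≡ h i j eq = p
  go refl (fall _ x<h _) = contradiction x<h (ℕₚ.≤⇒≯ (ℕₚ.m≤m+n h j))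

≤⇒∃+ : ∀ {m n} → m ≤ n → ∃ λ k → m ℕ.+ k ≡ n
≤⇒∃+ {m} {n} m≤n = n ∸ m , ℕₚ.m+[n∸m]≡n m≤n

-- The comparison of the head with `h` decides which constructor is possible, and the constructor
-- determines the next state. The decision serves as the indicator function in `weight`.
walk? : ∀ L h w → Dec (Walk L h w)
walk? L h []      = yes done
walk? L h (x ∷ w) with x <? h
walk? []      h (x ∷ w) | yes x<h = no λ p → case walk-fall x<h p of λ ()
walk? (y ∷ L) h (x ∷ w) | yes x<h with y ≟ x
... | yes refl = map′ (fall refl x<h) (λ p → case walk-fall x<h p of λ { (_ , refl , q) → q }) (walk? L h w)
... | no  y≢x  = no λ p → case walk-fall x<h p of λ { (_ , refl , _) → y≢x refl }
walk? L h (x ∷ w) | no x≮h with ≤⇒∃+ (ℕₚ.≮⇒≥ x≮h)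
... | j , refl = map′ (rise j) (walk-rise j) (walk? (L ++ range h j) (suc (h ℕ.+ j)) w)

-- Walks and 321-avoiding completions

Pending : List ℕ → ℕ → Set
Pending L h = AllPairs _<_ L × All (_< h) L

pending-rise : ∀ {L h} j → Pending L h → Pending (L ++ range h j) (h ℕ.+ j)
pending-rise {L} {h} j (inc , L<h) =
  AllPairsₚ.++⁺ inc (range-increasing h j)
    (All.map (λ x<h → All.map (ℕₚ.<-≤-trans x<h) (range-≥ h j)) L<h) ,
  Allₚ.++⁺ (All.map (λ x<h → ℕₚ.<-≤-trans x<h (ℕₚ.m≤m+n h j)) L<h) (range-< h j)

pending-suc : ∀ {L h} → Pending L h → Pending L (suc h)
pending-suc (inc , L<h) = inc , All.map ℕₚ.m<n⇒m<1+n L<h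

pending-fall : ∀ {x L h} → Pending (x ∷ L) h → Pending L h
pending-fall (_ ∷ inc , _ ∷ L<h) = inc , L<h

walk-∈ : ∀ {L h w} → Walk L h w → ∀ {y} → y ∈ w → y ∈ L ⊎ h ≤ y
walk-∈ {h = h} (rise j p) (here refl) = inj₂ (ℕₚ.m≤m+n h j)
walk-∈ {L} {h} (rise j p) (there y∈w) with walk-∈ p y∈w
... | inj₂ h+j<y = inj₂ (ℕₚ.≤-trans (ℕₚ.m≤m+n h j) (ℕₚ.<⇒≤ h+j<y))
... | inj₁ y∈L′ with ∈-++⁻ L y∈L′
...   | inj₁ y∈L = inj₁ y∈L
...   | inj₂ y∈R = inj₂ (All.lookup (range-≥ h j) y∈R)
walk-∈ (fall refl _ p) (here refl) = inj₁ (here refl)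
walk-∈ (fall refl _ p) (there y∈w) with walk-∈ p y∈w
... | inj₁ y∈L = inj₁ (there y∈L)
... | inj₂ h≤y = inj₂ h≤y

walk-distinct : ∀ {L h w} → Pending L h → Walk L h w → AllPairs _≢_ w
walk-distinct P done = []
walk-distinct {L} {h} P (rise j p) =
  All.tabulate (λ y∈w x≡y → distinct (walk-∈ p y∈w) x≡y) ∷ walk-distinct (pending-suc P′) p
  where
  P′ = pending-rise j P
  distinct : ∀ {y} → y ∈ L ++ range h j ⊎ h ℕ.+ j < y → h ℕ.+ j ≢ y
  distinct (inj₁ y∈L) x≡y = ℕₚ.<⇒≢ (All.lookup (proj₂ P′) y∈L) (sym x≡y)
  distinct (inj₂ x<y) x≡y = ℕₚ.<⇒≢ x<y x≡y
walk-distinct {x ∷ L} {h} P@(x<L ∷ _ , _) (fall refl x<h p) =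
  All.tabulate (λ y∈w → distinct (walk-∈ p y∈w)) ∷ walk-distinct (pending-fall P) p
  where
  distinct : ∀ {y} → y ∈ L ⊎ h ≤ y → x ≢ y
  distinct (inj₁ y∈L) = ℕₚ.<⇒≢ (All.lookup x<L y∈L)
  distinct (inj₂ h≤y) = ℕₚ.<⇒≢ (ℕₚ.<-≤-trans x<h h≤y)

-- A letter placed by `rise` is at least `h`, hence not below `b`; a letter placed by `fall` is the
-- least value still available, so nothing smaller follows it.
walk-increasing : ∀ {L h w b} → Pending L h → b ≤ h → Walk L h w → IncreasingBelow b w
walk-increasing P b≤h done = []
walk-increasing {h = h} P b≤h (rise j p) =
  All.tabulate (λ _ x<b → contradiction x<b (ℕₚ.≤⇒≯ b≤x)) ∷
  walk-increasing (pending-suc (pending-rise j P)) (ℕₚ.m≤n⇒m≤1+n b≤x) p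
  where
  b≤x = ℕₚ.≤-trans b≤h (ℕₚ.m≤m+n h j)
walk-increasing {x ∷ L} {h} P@(x<L ∷ _ , _) b≤h (fall refl x<h p) =
  All.tabulate (λ y∈w _ → x≤ (walk-∈ p y∈w)) ∷ walk-increasing (pending-fall P) b≤h p
  where
  x≤ : ∀ {y} → y ∈ L ⊎ h ≤ y → x ≤ y
  x≤ (inj₁ y∈L) = ℕₚ.<⇒≤ (All.lookup x<L y∈L)
  x≤ (inj₂ h≤y) = ℕₚ.<⇒≤ (ℕₚ.<-≤-trans x<h h≤y)

walk-avoids : ∀ {L h w} → Pending L h → Walk L h w → Avoids321 w
walk-avoids P done = _
walk-avoids P (rise j p) = walk-increasing P′ (ℕₚ.n≤1+n _) p , walk-avoids P′ p
  where P′ = pending-suc (pending-rise j P)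
walk-avoids P (fall refl x<h p) = walk-increasing P′ (ℕₚ.<⇒≤ x<h) p , walk-avoids P′ p
  where P′ = pending-fall P

∈-tail : ∀ {x y : ℕ} {w} → y ∈ x ∷ w → y ≢ x → y ∈ w
∈-tail (here y≡x)  y≢x = contradiction y≡x y≢x
∈-tail (there y∈w) y≢x = y∈w

-- The last three hypotheses say that the letters of `w` are exactly `L` and the values from `h` to
-- n - 1. `IncreasingBelow h w` is what avoidance with the earlier maximum as first letter leaves
-- behind; it forces any letter below `h` to be the head of `L`.
walk : ∀ {n L h w} → Pending L h → AllPairs _≢_ w → Avoids321 w → IncreasingBelow h w →
       All (_< n) w → (∀ {y} → y ∈ w → y ∈ L ⊎ h ≤ y) → (∀ {y} → y ∈ L → y ∈ w) →
       (∀ {y} → h ≤ y → y < n → y ∈ w) → Walk L h w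
walk {w = []} _ _ _ _ _ _ _ _ = done
walk {n} {L} {h} {x ∷ w} P (x≢w ∷ dw) (inc , av) (x≤w ∷ ih) (x<n ∷ w<n) w⊆ L⊆ R⊆ with x <? h
... | no x≮h with ≤⇒∃+ (ℕₚ.≮⇒≥ x≮h)
...   | j , refl = rise j (walk (pending-suc P′) dw av inc′ w<n w⊆′ L⊆′ R⊆′)
  where
  P′ = pending-rise j P
  -- Avoidance headed by the new maximum constrains letters strictly below it. Since that maximum
  -- does not recur in `w`, the bound can be raised by one to match the new state.
  inc′ : IncreasingBelow (suc (h ℕ.+ j)) w
  inc′ = strengthen x≢w inc
    where
    strengthen : ∀ {x v} → All (x ≢_) v → IncreasingBelow x v → IncreasingBelow (suc x) v
    strengthen []           []       = []
    strengthen (x≢y ∷ x≢v) (y≤ ∷ q) =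
      All.map (λ f y≤x → f (ℕₚ.≤∧≢⇒< (ℕ.s≤s⁻¹ y≤x) (x≢y ∘ sym))) y≤ ∷ strengthen x≢v q
  w⊆′ : ∀ {y} → y ∈ w → y ∈ L ++ range h j ⊎ suc (h ℕ.+ j) ≤ y
  w⊆′ {y} y∈w with w⊆ (there y∈w)
  ... | inj₁ y∈L = inj₁ (∈-++⁺ˡ y∈L)
  ... | inj₂ h≤y with y <? h ℕ.+ j
  ...   | yes y<x = inj₁ (∈-++⁺ʳ L (∈-range h j h≤y y<x))
  ...   | no  y≮x = inj₂ (ℕₚ.≤∧≢⇒< (ℕₚ.≮⇒≥ y≮x) (All.lookup x≢w y∈w))
  L⊆′ : ∀ {y} → y ∈ L ++ range h j → y ∈ w
  L⊆′ {y} y∈L′ with y<x ← All.lookup (proj₂ P′) y∈L′ | ∈-++⁻ L y∈L′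
  ... | inj₁ y∈L = ∈-tail (L⊆ y∈L) (ℕₚ.<⇒≢ y<x)
  ... | inj₂ y∈R = ∈-tail (R⊆ (All.lookup (range-≥ h j) y∈R) (ℕₚ.<-trans y<x x<n)) (ℕₚ.<⇒≢ y<x)
  R⊆′ : ∀ {y} → suc (h ℕ.+ j) ≤ y → y < n → y ∈ w
  R⊆′ x<y y<n = ∈-tail (R⊆ (ℕₚ.≤-trans (ℕₚ.m≤m+n h j) (ℕₚ.<⇒≤ x<y)) y<n) (ℕₚ.<⇒≢ x<y ∘ sym)
walk {n} {[]} {h} {x ∷ w} _ _ _ _ _ w⊆ _ _ | yes x<h with w⊆ (here refl)
... | inj₂ h≤x = contradiction x<h (ℕₚ.≤⇒≯ h≤x)
walk {n} {y ∷ L} {h} {x ∷ w} P@(y<L ∷ _ , _) (x≢w ∷ dw) (inc , av) (x≤w ∷ ih) (x<n ∷ w<n) w⊆ L⊆ R⊆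
  | yes x<h with y ≟ x
... | yes refl = fall refl x<h (walk (pending-fall P) dw av ih w<n w⊆′ L⊆′ R⊆′)
  where
  w⊆′ : ∀ {z} → z ∈ w → z ∈ L ⊎ h ≤ z
  w⊆′ z∈w with w⊆ (there z∈w)
  ... | inj₁ (here refl) = contradiction refl (All.lookup x≢w z∈w)
  ... | inj₁ (there z∈L) = inj₁ z∈L
  ... | inj₂ h≤z         = inj₂ h≤z
  L⊆′ : ∀ {z} → z ∈ L → z ∈ w
  L⊆′ z∈L = ∈-tail (L⊆ (there z∈L)) (ℕₚ.<⇒≢ (All.lookup y<L z∈L) ∘ sym)
  R⊆′ : ∀ {z} → h ≤ z → z < n → z ∈ w
  R⊆′ h≤z z<n = ∈-tail (R⊆ h≤z z<n) (ℕₚ.<⇒≢ (ℕₚ.<-≤-trans x<h h≤z) ∘ sym)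
... | no y≢x = contradiction y<x (ℕₚ.≤⇒≯ x≤y)
  where
  -- The least unused value y still has to be placed, but x already was.
  x≤y : x ≤ y
  x≤y = All.lookup x≤w (∈-tail (L⊆ (here refl)) y≢x) x<h
  y<x : y < x
  y<x with w⊆ (here refl)
  ... | inj₁ (here x≡y)  = contradiction (sym x≡y) y≢x
  ... | inj₁ (there x∈L) = All.lookup y<L x∈L
  ... | inj₂ h≤x         = contradiction x<h (ℕₚ.≤⇒≯ h≤x)

-- Inversions and records along a walk

countBelow-all : ∀ {b w} → All (_< b) w → countBelow b w ≡ length w
countBelow-all {b} []          = refl
countBelow-all {b} {x ∷ w} (x<b ∷ w<b) with x <ᵇ b | ℕₚ.<⇒<ᵇ x<b
... | true | _ = cong suc (countBelow-all w<b)

countBelow-none : ∀ {b w} → All (b ≤_) w → countBelow b w ≡ 0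
countBelow-none {b} []          = refl
countBelow-none {b} {x ∷ w} (b≤x ∷ b≤w) with x <ᵇ b in eq
... | false = countBelow-none b≤w
... | true  = contradiction (ℕₚ.<ᵇ⇒< x b (subst T (sym eq) _)) (ℕₚ.≤⇒≯ b≤x)

countBelow-++ : ∀ b v w → countBelow b (v ++ w) ≡ countBelow b v ℕ.+ countBelow b w
countBelow-++ b v w = trans (cong length (filterᵇ-++ (_<ᵇ b) v w)) (Listₚ.length-++ (filterᵇ (_<ᵇ b) v))

length-rise : ∀ {n h x} L j → x ℕ.+ h ≡ length L ℕ.+ n →
              x ℕ.+ (h ℕ.+ j) ≡ length (L ++ range h j) ℕ.+ n
length-rise {n} {h} {x} L j eq = begin
  x ℕ.+ (h ℕ.+ j)                    ≡⟨ ℕₚ.+-assoc x h j ⟨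
  x ℕ.+ h ℕ.+ j                      ≡⟨ cong (ℕ._+ j) eq ⟩
  length L ℕ.+ n ℕ.+ j               ≡⟨ ℕₚ.+-assoc (length L) n j ⟩
  length L ℕ.+ (n ℕ.+ j)             ≡⟨ cong (length L ℕ.+_) (ℕₚ.+-comm n j) ⟩
  length L ℕ.+ (j ℕ.+ n)             ≡⟨ ℕₚ.+-assoc (length L) j n ⟨
  length L ℕ.+ j ℕ.+ n               ≡⟨ cong (λ i → length L ℕ.+ i ℕ.+ n) (length-range h j) ⟨
  length L ℕ.+ length (range h j) ℕ.+ n ≡⟨ cong (ℕ._+ n) (Listₚ.length-++ L) ⟨
  length (L ++ range h j) ℕ.+ n      ∎
  where open ≡-Reasoning

-- A `rise` neither places nor releases a value below `b`, and a `fall` removes the same letter from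
-- both sides. The length equation says that `w` has room for all of `L` and all n - h larger
-- values, so the walk cannot end with values still pending: that would give h > n.
countBelow-walk : ∀ {n L h w b} → All (_< n) w → h ≤ n → length w ℕ.+ h ≡ length L ℕ.+ n →
                  b ≤ h → Walk L h w → countBelow b w ≡ countBelow b L
countBelow-walk {n} {[]}    _ h≤n eq b≤h done = refl
countBelow-walk {n} {x ∷ L} _ h≤n eq b≤h done =
  contradiction (subst (_≤ n) eq h≤n) (ℕₚ.<⇒≱ (s≤s (ℕₚ.m≤n+m n (length L))))
countBelow-walk {n} {L} {h} {x ∷ w} {b} (x<n ∷ w<n) h≤n eq b≤h (rise j p) = begin
  countBelow b (h ℕ.+ j ∷ w)
    ≡⟨ countBelow-++ b (h ℕ.+ j ∷ []) w ⟩
  countBelow b (h ℕ.+ j ∷ []) ℕ.+ countBelow b w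
    ≡⟨ cong₂ ℕ._+_ (countBelow-none (b≤x ∷ [])) (countBelow-walk w<n x<n eq′ (ℕₚ.m≤n⇒m≤1+n b≤x) p) ⟩
  countBelow b (L ++ range h j)
    ≡⟨ countBelow-++ b L (range h j) ⟩
  countBelow b L ℕ.+ countBelow b (range h j)
    ≡⟨ cong (countBelow b L ℕ.+_) (countBelow-none (All.map (ℕₚ.≤-trans b≤h) (range-≥ h j))) ⟩
  countBelow b L ℕ.+ 0
    ≡⟨ ℕₚ.+-identityʳ _ ⟩
  countBelow b L ∎
  where
  open ≡-Reasoning
  b≤x = ℕₚ.≤-trans b≤h (ℕₚ.m≤m+n h j)
  eq′ : length w ℕ.+ suc (h ℕ.+ j) ≡ length (L ++ range h j) ℕ.+ n
  eq′ = trans (ℕₚ.+-suc (length w) (h ℕ.+ j)) (length-rise {x = suc (length w)} L j eq)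
countBelow-walk {b = b} (_ ∷ w<n) h≤n eq b≤h (fall {x} {L} {w} refl x<h p) = begin
  countBelow b (x ∷ w)                           ≡⟨ countBelow-++ b (x ∷ []) w ⟩
  countBelow b (x ∷ []) ℕ.+ countBelow b w       ≡⟨ cong (countBelow b (x ∷ []) ℕ.+_) (countBelow-walk w<n h≤n (ℕₚ.suc-injective eq) b≤h p) ⟩
  countBelow b (x ∷ []) ℕ.+ countBelow b L       ≡⟨ countBelow-++ b (x ∷ []) L ⟨
  countBelow b (x ∷ L)                           ∎
  where open ≡-Reasoning

-- After a rise `recordsFrom` keeps the letter itself as threshold while the walk state is one
-- larger. No letter of the walk lies between the two: pending letters are below both, rises are
-- above both, and the first rise resets the threshold.
recordsFrom-walk : ∀ {h h′ L w} → All (_< h) L → h ≤ h′ → Walk L h′ w → recordsFrom h w ≡ recordsFrom h′ w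
recordsFrom-walk L<h h≤h′ done = refl
recordsFrom-walk {h} {h′} L<h h≤h′ (rise j p)
  rewrite ≤ᵇ-true (ℕₚ.≤-trans h≤h′ (ℕₚ.m≤m+n h′ j)) | ≤ᵇ-true (ℕₚ.m≤m+n h′ j) = refl
recordsFrom-walk (x<h ∷ L<h) h≤h′ (fall refl x<h′ p)
  rewrite ≤ᵇ-false x<h | ≤ᵇ-false x<h′ = recordsFrom-walk L<h h≤h′ p

-- The generating function of the completions

-- Multiplication by c t.
shift : ℤ → Poly → Poly
shift c p zero    = 0ℤ
shift c p (suc k) = c ℤ.* p k

shift-cong : ∀ c {p q} → p ≈ q → shift c p ≈ shift c q
shift-cong c p≈q zero    = refl
shift-cong c p≈q (suc k) = cong (c ℤ.*_) (p≈q k)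

shift-mono : ∀ c d m → mono (c ℤ.* d) (suc m) ≈ shift c (mono d m)
shift-mono c d m zero = refl
shift-mono c d m (suc k) with k ≡ᵇ m
... | true  = refl
... | false = sym (ℤₚ.*-zeroʳ c)

shift-0p : ∀ c → shift c 0p ≈ 0p
shift-0p c zero    = refl
shift-0p c (suc k) = ℤₚ.*-zeroʳ c

-- Only inversions inside `w` are counted; those with a prefix letter were charged when that letter
-- was placed. The value zero off walks lets sums range over all vectors.
weight : List ℕ → ℕ → List ℕ → Poly
weight L h w = if does (walk? L h w) then mono (-1ℤ ℤ.^ inversions w) (recordsFrom h w) else 0p

if-does : {P Q : Set} (P? : Dec P) (Q? : Dec Q) → P ⇔ Q → ∀ {p q} → (Q → p ≈ q) →
          (if does P? then p else 0p) ≈ (if does Q? then q else 0p)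
if-does (yes _) (yes q) _   p≈q k = p≈q q k
if-does (no _)  (no _)  _   _   k = refl
if-does (yes p) (no ¬q) P⇔Q _   k = contradiction (Equivalence.to P⇔Q p) ¬q
if-does (no ¬p) (yes q) P⇔Q _   k = contradiction (Equivalence.from P⇔Q q) ¬p

if-shift : ∀ b c p → shift c (if b then p else 0p) ≈ (if b then shift c p else 0p)
if-shift true  c p k = refl
if-shift false c p k = shift-0p c k

weight-rise : ∀ {n L h j w} → Pending L h → All (_< n) w → h ℕ.+ j < n →
              suc (length w) ℕ.+ h ≡ length L ℕ.+ n →
              weight L h (h ℕ.+ j ∷ w) ≈
              shift (-1ℤ ℤ.^ (length L ℕ.+ j)) (weight (L ++ range h j) (suc (h ℕ.+ j)) w)
weight-rise {n} {L} {h} {j} {w} P w<n x<n eq k = trans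
  (if-does (walk? L h (h ℕ.+ j ∷ w)) (walk? L′ (suc (h ℕ.+ j)) w) (mk⇔ (walk-rise j) (rise j)) monos k)
  (sym (if-shift (does (walk? L′ (suc (h ℕ.+ j)) w)) _ _ k))
  where
  L′ = L ++ range h j
  P′ = pending-rise j P
  monos : Walk L′ (suc (h ℕ.+ j)) w →
          mono (-1ℤ ℤ.^ inversions (h ℕ.+ j ∷ w)) (recordsFrom h (h ℕ.+ j ∷ w)) ≈
          shift (-1ℤ ℤ.^ (length L ℕ.+ j)) (mono (-1ℤ ℤ.^ inversions w) (recordsFrom (suc (h ℕ.+ j)) w))
  monos p k rewrite ≤ᵇ-true (ℕₚ.m≤m+n h j) | recordsFrom-walk (proj₂ P′) (ℕₚ.n≤1+n _) p = begin
    mono (-1ℤ ℤ.^ inversions (h ℕ.+ j ∷ w)) (suc r) k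
      ≡⟨ cong (λ i → mono (-1ℤ ℤ.^ (i ℕ.+ inversions w)) (suc r) k) below ⟩
    mono (-1ℤ ℤ.^ (length L ℕ.+ j ℕ.+ inversions w)) (suc r) k
      ≡⟨ cong (λ c → mono c (suc r) k) (ℤₚ.^-distribˡ-+-* -1ℤ (length L ℕ.+ j) (inversions w)) ⟩
    mono (-1ℤ ℤ.^ (length L ℕ.+ j) ℤ.* -1ℤ ℤ.^ inversions w) (suc r) k
      ≡⟨ shift-mono _ _ r k ⟩
    shift (-1ℤ ℤ.^ (length L ℕ.+ j)) (mono (-1ℤ ℤ.^ inversions w) r) k ∎
    where
    open ≡-Reasoning
    r = recordsFrom (suc (h ℕ.+ j)) w
    below : countBelow (h ℕ.+ j) w ≡ length L ℕ.+ j
    below = begin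
      countBelow (h ℕ.+ j) w
        ≡⟨ countBelow-walk w<n x<n (trans (ℕₚ.+-suc (length w) (h ℕ.+ j)) (length-rise {x = suc (length w)} L j eq)) (ℕₚ.n≤1+n _) p ⟩
      countBelow (h ℕ.+ j) L′              ≡⟨ countBelow-all (proj₂ P′) ⟩
      length L′                            ≡⟨ Listₚ.length-++ L ⟩
      length L ℕ.+ length (range h j)      ≡⟨ cong (length L ℕ.+_) (length-range h j) ⟩
      length L ℕ.+ j                       ∎

weight-fall : ∀ {n x L h w} → Pending (x ∷ L) h → All (_< n) w → h ≤ n →
              length w ℕ.+ h ≡ length L ℕ.+ n →
              weight (x ∷ L) h (x ∷ w) ≈ weight L h w
weight-fall {n} {x} {L} {h} {w} P@(x<L ∷ _ , x<h ∷ _) w<n h≤n eq =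
  if-does (walk? (x ∷ L) h (x ∷ w)) (walk? L h w)
    (mk⇔ (λ p → case walk-fall x<h p of λ { (_ , refl , q) → q }) (fall refl x<h)) monos
  where
  monos : Walk L h w → mono (-1ℤ ℤ.^ inversions (x ∷ w)) (recordsFrom h (x ∷ w)) ≈
                       mono (-1ℤ ℤ.^ inversions w) (recordsFrom h w)
  monos p k rewrite ≤ᵇ-false x<h | countBelow-walk w<n h≤n eq (ℕₚ.<⇒≤ x<h) p
                  | countBelow-none (All.map ℕₚ.<⇒≤ x<L) = refl

weight-stuck : ∀ {L h x w} → x < h → (∀ {L′} → L ≢ x ∷ L′) → weight L h (x ∷ w) ≈ 0p
weight-stuck {L} {h} {x} {w} x<h L≢ k with walk? L h (x ∷ w)
... | no _  = refl
... | yes p = let _ , eq , _ = walk-fall x<h p in contradiction eq L≢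

-- Finite sums

sumZ-++ : ∀ xs ys → sumZ (xs ++ ys) ≡ sumZ xs ℤ.+ sumZ ys
sumZ-++ []       ys = sym (ℤₚ.+-identityˡ _)
sumZ-++ (x ∷ xs) ys = trans (cong (ℤ._+_ x) (sumZ-++ xs ys)) (sym (ℤₚ.+-assoc x (sumZ xs) (sumZ ys)))

sumZ-concatMap : (f : B → ℤ) (g : A → List B) (xs : List A) →
                 sumZ (map f (concatMap g xs)) ≡ sumZ (map (λ x → sumZ (map f (g x))) xs)
sumZ-concatMap f g []       = refl
sumZ-concatMap f g (x ∷ xs) = begin
  sumZ (map f (g x ++ concatMap g xs))                ≡⟨ cong sumZ (Listₚ.map-++ f (g x) _) ⟩
  sumZ (map f (g x) ++ map f (concatMap g xs))        ≡⟨ sumZ-++ (map f (g x)) _ ⟩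
  sumZ (map f (g x)) ℤ.+ sumZ (map f (concatMap g xs)) ≡⟨ cong (ℤ._+_ (sumZ (map f (g x)))) (sumZ-concatMap f g xs) ⟩
  sumZ (map (λ x → sumZ (map f (g x))) (x ∷ xs))      ∎
  where open ≡-Reasoning

sumZ-shift : ∀ c (f : A → Poly) xs k →
             sumZ (map (λ x → shift c (f x) k) xs) ≡ shift c (λ i → sumZ (map (λ x → f x i) xs)) k
sumZ-shift c f []       zero    = refl
sumZ-shift c f []       (suc k) = sym (ℤₚ.*-zeroʳ c)
sumZ-shift c f (x ∷ xs) zero    = trans (ℤₚ.+-identityˡ _) (sumZ-shift c f xs zero)
sumZ-shift c f (x ∷ xs) (suc k) =
  trans (cong (ℤ._+_ (c ℤ.* f x k)) (sumZ-shift c f xs (suc k))) (sym (ℤₚ.*-distribˡ-+ c (f x k) _))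

sumZ-zero : {f : A → ℤ} → (∀ x → f x ≡ 0ℤ) → ∀ xs → sumZ (map f xs) ≡ 0ℤ
sumZ-zero f≡0 []       = refl
sumZ-zero f≡0 (x ∷ xs) = cong₂ ℤ._+_ (f≡0 x) (sumZ-zero f≡0 xs)

∑ : ℕ → (ℕ → ℤ) → ℤ
∑ n f = sumZ (applyUpTo f n)

∑-cong : ∀ {f g} n → (∀ i → i < n → f i ≡ g i) → ∑ n f ≡ ∑ n g
∑-cong zero    eq = refl
∑-cong (suc n) eq = cong₂ ℤ._+_ (eq 0 (s≤s z≤n)) (∑-cong n (λ i i<n → eq (suc i) (s≤s i<n)))

∑-zero : ∀ {f} n → (∀ i → i < n → f i ≡ 0ℤ) → ∑ n f ≡ 0ℤ
∑-zero zero    eq = refl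
∑-zero (suc n) eq = cong₂ ℤ._+_ (eq 0 (s≤s z≤n)) (∑-zero n (λ i i<n → eq (suc i) (s≤s i<n)))

∑-+ : ∀ m n f → ∑ (m ℕ.+ n) f ≡ ∑ m f ℤ.+ ∑ n (λ i → f (m ℕ.+ i))
∑-+ zero    n f = sym (ℤₚ.+-identityˡ _)
∑-+ (suc m) n f = trans (cong (ℤ._+_ (f 0)) (∑-+ m n (f ∘ suc))) (sym (ℤₚ.+-assoc (f 0) _ _))

∑-single : ∀ {f} n i → i < n → (∀ j → j < n → j ≢ i → f j ≡ 0ℤ) → ∑ n f ≡ f i
∑-single {f} (suc n) zero    i<n       eq =
  trans (cong (ℤ._+_ (f 0)) (∑-zero n (λ j j<n → eq (suc j) (s≤s j<n) (λ ())))) (ℤₚ.+-identityʳ (f 0))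
∑-single {f} (suc n) (suc i) (s≤s i<n) eq =
  trans (cong₂ ℤ._+_ (eq 0 (s≤s z≤n) (λ ()))
          (∑-single n i i<n (λ j j<n j≢i → eq (suc j) (s≤s j<n) (j≢i ∘ ℕₚ.suc-injective))))
        (ℤₚ.+-identityˡ (f (suc i)))

sumZ-allFin : ∀ n (f : ℕ → ℤ) → sumZ (map (f ∘ toℕ) (allFin n)) ≡ ∑ n f
sumZ-allFin zero    f = refl
sumZ-allFin (suc n) f = cong (ℤ._+_ (f 0)) (begin
  sumZ (map (f ∘ toℕ) (tabulate {n = n} Fin.suc))          ≡⟨ cong (sumZ ∘ map (f ∘ toℕ)) (Listₚ.map-tabulate {n = n} id Fin.suc) ⟨
  sumZ (map (f ∘ toℕ) (map Fin.suc (allFin n)))    ≡⟨ cong sumZ (Listₚ.map-∘ (allFin n)) ⟨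
  sumZ (map (f ∘ suc ∘ toℕ) (allFin n))            ≡⟨ sumZ-allFin n (f ∘ suc) ⟩
  ∑ n (f ∘ suc)                                    ∎)
  where open ≡-Reasoning

-- The telescoped recurrence and the direct one

-- F d r enumerates the ways to complete a prefix with d unused values below its maximum and r
-- values above it. This is the recurrence for placing the next letter, telescoped: raising the
-- new maximum by one turns a completion from (d , 1 + r) into one from (1 + d , r).
F : ℕ → ℕ → Poly
F d       zero    k = cst 1ℤ k
F zero    (suc r) k = F 1 r k ℤ.+ (shift 1ℤ (F 0 r) k ℤ.- F 0 r k)
F (suc d) (suc r) k = F d (suc r) k ℤ.+
  (F (suc (suc d)) r k ℤ.+ (shift (-1ℤ ℤ.^ suc d) (F (suc d) r) k ℤ.- F (suc d) r k))

rises : ℕ → ℕ → Poly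
rises d r k = ∑ r (λ j → shift (-1ℤ ℤ.^ (d ℕ.+ j)) (F (d ℕ.+ j) (r ∸ suc j)) k)

rises-suc : ∀ d r → rises d (suc r) ≈ shift (-1ℤ ℤ.^ d) (F d r) ⊕ rises (suc d) r
rises-suc d r k = cong₂ ℤ._+_
  (cong (λ i → shift (-1ℤ ℤ.^ i) (F i r) k) (ℕₚ.+-identityʳ d))
  (∑-cong r (λ j _ → cong (λ i → shift (-1ℤ ℤ.^ i) (F i (r ∸ suc j)) k) (ℕₚ.+-suc d j)))

x+y+[z-x]≡z+y : ∀ x y z → (x ℤ.+ y) ℤ.+ (z ℤ.- x) ≡ z ℤ.+ y
x+y+[z-x]≡z+y = solve-∀

F-suc : ∀ d r → F (suc d) r ≈ F d r ⊕ rises (suc d) r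
F-suc d zero    k = sym (ℤₚ.+-identityʳ _)
F-suc d (suc r) k = cong (ℤ._+_ (F d (suc r) k)) (begin
  F (suc (suc d)) r k ℤ.+ (u ℤ.- F (suc d) r k)
    ≡⟨ cong (ℤ._+ (u ℤ.- F (suc d) r k)) (F-suc (suc d) r k) ⟩
  F (suc d) r k ℤ.+ rises (suc (suc d)) r k ℤ.+ (u ℤ.- F (suc d) r k)
    ≡⟨ x+y+[z-x]≡z+y (F (suc d) r k) _ u ⟩
  u ℤ.+ rises (suc (suc d)) r k
    ≡⟨ rises-suc (suc d) r k ⟨
  rises (suc d) (suc r) k ∎)
  where
  open ≡-Reasoning
  u = shift (-1ℤ ℤ.^ suc d) (F (suc d) r) k

F-zero : ∀ r → F 0 (suc r) ≈ rises 0 (suc r)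
F-zero r k = begin
  F 1 r k ℤ.+ (u ℤ.- F 0 r k)                     ≡⟨ cong (ℤ._+ (u ℤ.- F 0 r k)) (F-suc 0 r k) ⟩
  F 0 r k ℤ.+ rises 1 r k ℤ.+ (u ℤ.- F 0 r k)     ≡⟨ x+y+[z-x]≡z+y (F 0 r k) _ u ⟩
  u ℤ.+ rises 1 r k                               ≡⟨ rises-suc 0 r k ⟨
  rises 0 (suc r) k                               ∎
  where
  open ≡-Reasoning
  u = shift 1ℤ (F 0 r) k

-- From permutations to `F`

word-< : ∀ {n m} (v : Vec (Fin n) m) → All (_< n) (word v)
word-< v = Allₚ.tabulate⁺ (λ i → Finₚ.toℕ<n (lookup v i))

distinct⇒injective : ∀ {n m} (σ : Vec (Fin n) m) → AllPairs _≢_ (word σ) → ∀ {i j} → lookup σ i ≡ lookup σ j → i ≡ j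
distinct⇒injective (x Vec.∷ σ) (x∉ ∷ d) {Fin.zero}  {Fin.zero}  eq = refl
distinct⇒injective (x Vec.∷ σ) (x∉ ∷ d) {Fin.zero}  {Fin.suc j} eq = contradiction (cong toℕ eq) (Allₚ.tabulate⁻ x∉ j)
distinct⇒injective (x Vec.∷ σ) (x∉ ∷ d) {Fin.suc i} {Fin.zero}  eq = contradiction (cong toℕ (sym eq)) (Allₚ.tabulate⁻ x∉ i)
distinct⇒injective (x Vec.∷ σ) (x∉ ∷ d) {Fin.suc i} {Fin.suc j} eq = cong Fin.suc (distinct⇒injective σ d eq)

-- Pigeonhole: a missed value put in front of the letters of σ would give an injection from
-- `Fin (suc n)` into `Fin n`.
distinct⇒covers : ∀ {n} (σ : Vec (Fin n) n) → AllPairs _≢_ (word σ) → ∀ {y} → y < n → y ∈ word σ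
distinct⇒covers {n} σ d {y} y<n = missing (Finₚ.any? (λ i → lookup σ i Finₚ.≟ x))
  where
  x = Fin.fromℕ< y<n
  missing : Dec (∃ λ i → lookup σ i ≡ x) → y ∈ word σ
  missing (yes (i , σi≡x)) = subst (_∈ word σ) (trans (cong toℕ σi≡x) (Finₚ.toℕ-fromℕ< y<n)) (∈-tabulate⁺ i)
  missing (no ∄i) = contradiction (Finₚ.injective⇒≤ {f = extended} injective) ℕₚ.1+n≰n
    where
    extended : Fin (suc n) → Fin n
    extended Fin.zero    = x
    extended (Fin.suc i) = lookup σ i
    injective : ∀ {i j} → extended i ≡ extended j → i ≡ j
    injective {Fin.zero}  {Fin.zero}  eq = refl
    injective {Fin.zero}  {Fin.suc j} eq = contradiction (j , sym eq) ∄i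
    injective {Fin.suc i} {Fin.zero}  eq = contradiction (i , eq) ∄i
    injective {Fin.suc i} {Fin.suc j} eq = cong Fin.suc (distinct⇒injective σ d eq)

av⇔walk : ∀ {n} (σ : Vec (Fin n) n) → T (isPerm σ ∧ avoids321 σ) ⇔ Walk [] 0 (word σ)
av⇔walk σ = mk⇔
  (λ t → let p , a = Equivalence.to T-∧ t; d = Equivalence.to (isPerm-word σ) p in
    walk ([] , []) d (Equivalence.to (avoids321-word σ) a)
      -- For the empty prefix h = 0, so `IncreasingBelow 0` is vacuous and any relation on pairs of
      -- letters can be mapped to it.
      (AllPairs.map (λ _ ()) d) (word-< σ) (λ _ → inj₂ z≤n) (λ ()) (λ _ → distinct⇒covers σ d))
  (λ p → Equivalence.from T-∧
    ( Equivalence.from (isPerm-word σ) (walk-distinct ([] , []) p)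
    , Equivalence.from (avoids321-word σ) (walk-avoids ([] , []) p)))

completions : ∀ n m → List ℕ → ℕ → Poly
completions n m L h k = sumZ (map (λ v → weight L h (word v) k) (allVecs n m))

completions-∷ : ∀ n m L h k → completions n (suc m) L h k ≡
  ∑ n (λ x → sumZ (map (λ v → weight L h (x ∷ word v) k) (allVecs n m)))
completions-∷ n m L h k = begin
  completions n (suc m) L h k
    ≡⟨ sumZ-concatMap _ _ (allFin n) ⟩
  sumZ (map (λ x → sumZ (map (λ v → weight L h (word v) k) (map (x Vec.∷_) (allVecs n m)))) (allFin n))
    ≡⟨ cong sumZ (Listₚ.map-cong (λ x → cong sumZ (sym (Listₚ.map-∘ (allVecs n m)))) (allFin n)) ⟩
  sumZ (map (λ x → sumZ (map (λ v → weight L h (toℕ x ∷ word v) k) (allVecs n m))) (allFin n))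
    ≡⟨ sumZ-allFin n _ ⟩
  ∑ n (λ x → sumZ (map (λ v → weight L h (x ∷ word v) k) (allVecs n m))) ∎
  where open ≡-Reasoning

letters-left : ∀ {n m r} h l (v : Vec (Fin n) m) → suc m ≡ l ℕ.+ r →
               suc (length (word v)) ℕ.+ h ≡ l ℕ.+ (h ℕ.+ r)
letters-left {m = m} {r} h l v eq = begin
  suc (length (word v)) ℕ.+ h  ≡⟨ cong (λ i → suc i ℕ.+ h) (Listₚ.length-tabulate (toℕ ∘ lookup v)) ⟩
  suc m ℕ.+ h                  ≡⟨ cong (ℕ._+ h) eq ⟩
  l ℕ.+ r ℕ.+ h                ≡⟨ ℕₚ.+-assoc l r h ⟩
  l ℕ.+ (r ℕ.+ h)              ≡⟨ cong (l ℕ.+_) (ℕₚ.+-comm r h) ⟩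
  l ℕ.+ (h ℕ.+ r)              ∎
  where open ≡-Reasoning

-- Of all first letters below `h` only the head of `L` has nonzero weight, and if `L` is empty none
-- has. The value after that letter is passed as a hypothesis on the tail of `L`, which the caller
-- supplies by induction.
falls : ∀ {m r L h} → Pending L h → suc m ≡ length L ℕ.+ r → ∀ k →
        (∀ {x L′} → L ≡ x ∷ L′ → completions (h ℕ.+ r) m L′ h k ≡ F (length L′) r k) →
        ∑ h (λ x → sumZ (map (λ v → weight L h (x ∷ word v) k) (allVecs (h ℕ.+ r) m))) ℤ.+
          rises (length L) r k ≡ F (length L) r k
falls {m} {suc r} {[]} {h} P eq k _ = trans
  (cong₂ ℤ._+_ (∑-zero h (λ x x<h → sumZ-zero (λ v → weight-stuck {w = word v} x<h (λ ()) k) (allVecs (h ℕ.+ suc r) m)))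
    (sym (F-zero r k)))
  (ℤₚ.+-identityˡ _)
falls {m} {r} {y ∷ L} {h} P@(_ , y<h ∷ _) eq k ih = begin
  ∑ h φ ℤ.+ rises (suc (length L)) r k      ≡⟨ cong (ℤ._+ rises (suc (length L)) r k) (∑-single h y y<h stuck) ⟩
  φ y ℤ.+ rises (suc (length L)) r k        ≡⟨ cong (ℤ._+ rises (suc (length L)) r k) (trans fallen (ih refl)) ⟩
  F (length L) r k ℤ.+ rises (suc (length L)) r k ≡⟨ F-suc (length L) r k ⟨
  F (suc (length L)) r k                    ∎
  where
  open ≡-Reasoning
  n = h ℕ.+ r
  φ : ℕ → ℤ
  φ x = sumZ (map (λ v → weight (y ∷ L) h (x ∷ word v) k) (allVecs n m))
  stuck : ∀ x → x < h → x ≢ y → φ x ≡ 0ℤ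
  stuck x x<h x≢y = sumZ-zero (λ v → weight-stuck {w = word v} x<h (λ { refl → x≢y refl }) k) (allVecs n m)
  fallen : φ y ≡ completions n m L h k
  fallen = cong sumZ (Listₚ.map-cong
    (λ v → weight-fall {w = word v} P (word-< v) (ℕₚ.m≤m+n h r)
      (ℕₚ.suc-injective (letters-left h (suc (length L)) v eq)) k) (allVecs n m))

-- Induction on the number m of letters to place. The values in `L` disappear from the answer
-- because neither the signs nor the records in `weight-rise` and `weight-fall` see more than its
-- length.
completions≈F : ∀ m r {L h} → Pending L h → m ≡ length L ℕ.+ r → completions (h ℕ.+ r) m L h ≈ F (length L) r
completions≈F zero zero {[]} P eq k = ℤₚ.+-identityʳ _
completions≈F (suc m) r {L} {h} P eq k = begin
  completions n (suc m) L h k                   ≡⟨ completions-∷ n m L h k ⟩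
  ∑ (h ℕ.+ r) φ                                 ≡⟨ ∑-+ h r φ ⟩
  ∑ h φ ℤ.+ ∑ r (λ j → φ (h ℕ.+ j))             ≡⟨ cong (ℤ._+_ (∑ h φ)) (∑-cong r high) ⟩
  ∑ h φ ℤ.+ rises (length L) r k                ≡⟨ falls {m} {r} P eq k (λ L≡ → completions≈F m r
                                                       (pending-fall (subst (λ L → Pending L h) L≡ P))
                                                       (ℕₚ.suc-injective (trans eq (cong (λ L → length L ℕ.+ r) L≡))) k) ⟩
  F (length L) r k                              ∎
  where
  open ≡-Reasoning
  n = h ℕ.+ r
  φ : ℕ → ℤ
  φ x = sumZ (map (λ v → weight L h (x ∷ word v) k) (allVecs n m))

  high : ∀ j → j < r → φ (h ℕ.+ j) ≡ shift (-1ℤ ℤ.^ (length L ℕ.+ j)) (F (length L ℕ.+ j) (r ∸ suc j)) k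
  high j j<r = begin
    φ (h ℕ.+ j)
      ≡⟨ cong sumZ (Listₚ.map-cong (λ v → weight-rise P (word-< v) (ℕₚ.+-monoʳ-< h j<r) (letters-left h (length L) v eq) k) (allVecs n m)) ⟩
    sumZ (map (λ v → shift c (weight L′ (suc (h ℕ.+ j)) (word v)) k) (allVecs n m))
      ≡⟨ sumZ-shift c _ (allVecs n m) k ⟩
    shift c (completions n m L′ (suc (h ℕ.+ j))) k
      ≡⟨ cong (λ n → shift c (completions n m L′ (suc (h ℕ.+ j))) k) n≡ ⟩
    shift c (completions (suc (h ℕ.+ j) ℕ.+ (r ∸ suc j)) m L′ (suc (h ℕ.+ j))) k
      ≡⟨ shift-cong c (completions≈F m (r ∸ suc j) (pending-suc (pending-rise j P)) m≡) k ⟩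
    shift c (F (length L′) (r ∸ suc j)) k
      ≡⟨ cong (λ d → shift c (F d (r ∸ suc j)) k) length-L′ ⟩
    shift c (F (length L ℕ.+ j) (r ∸ suc j)) k ∎
    where
    c = -1ℤ ℤ.^ (length L ℕ.+ j)
    L′ = L ++ range h j
    length-L′ : length L′ ≡ length L ℕ.+ j
    length-L′ = trans (Listₚ.length-++ L) (cong (length L ℕ.+_) (length-range h j))
    r≡ : suc j ℕ.+ (r ∸ suc j) ≡ r
    r≡ = ℕₚ.m+[n∸m]≡n j<r
    -- The alphabet is the same, but it is now divided at the new maximum.
    n≡ : n ≡ suc (h ℕ.+ j) ℕ.+ (r ∸ suc j)
    n≡ = begin
      h ℕ.+ r                          ≡⟨ cong (h ℕ.+_) r≡ ⟨
      h ℕ.+ (suc j ℕ.+ (r ∸ suc j))    ≡⟨ ℕₚ.+-assoc h (suc j) _ ⟨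
      h ℕ.+ suc j ℕ.+ (r ∸ suc j)      ≡⟨ cong (ℕ._+ (r ∸ suc j)) (ℕₚ.+-suc h j) ⟩
      suc (h ℕ.+ j) ℕ.+ (r ∸ suc j)    ∎
    m≡ : m ≡ length L′ ℕ.+ (r ∸ suc j)
    m≡ = ℕₚ.suc-injective (begin
      suc m                                      ≡⟨ eq ⟩
      length L ℕ.+ r                             ≡⟨ cong (length L ℕ.+_) r≡ ⟨
      length L ℕ.+ suc (j ℕ.+ (r ∸ suc j))       ≡⟨ ℕₚ.+-suc (length L) _ ⟩
      suc (length L ℕ.+ (j ℕ.+ (r ∸ suc j)))     ≡⟨ cong suc (ℕₚ.+-assoc (length L) j _) ⟨
      suc (length L ℕ.+ j ℕ.+ (r ∸ suc j))       ≡⟨ cong (λ l → suc (l ℕ.+ (r ∸ suc j))) length-L′ ⟨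
      suc (length L′ ℕ.+ (r ∸ suc j))            ∎)

I≈F : ∀ n → I-1 n ≈ F 0 n
I≈F n k = begin
  I-1 n k                          ≡⟨ sumP-filterᵇ _ _ (allVecs n n) k ⟩
  sumZ (map (λ σ → (if isPerm σ ∧ avoids321 σ then mono (-1ℤ ℤ.^ inv σ) (lrm σ) else 0p) k) (allVecs n n))
                                   ≡⟨ cong sumZ (Listₚ.map-cong (λ σ → summand σ k) (allVecs n n)) ⟩
  completions n n [] 0 k           ≡⟨ completions≈F n n ([] , []) refl k ⟩
  F 0 n k                          ∎
  where
  open ≡-Reasoning
  sumP-filterᵇ : (p : A → Bool) (f : A → Poly) → ∀ xs k →
                 sumP (map f (filterᵇ p xs)) k ≡ sumZ (map (λ x → (if p x then f x else 0p) k) xs)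
  sumP-filterᵇ p f []       k = refl
  sumP-filterᵇ p f (x ∷ xs) k with p x
  ... | true  = cong (ℤ._+_ (f x k)) (sumP-filterᵇ p f xs k)
  ... | false = trans (sumP-filterᵇ p f xs k) (sym (ℤₚ.+-identityˡ _))

  summand : ∀ σ → (if isPerm σ ∧ avoids321 σ then mono (-1ℤ ℤ.^ inv σ) (lrm σ) else 0p) ≈
                  weight [] 0 (word σ)
  summand σ = if-does (T? (isPerm σ ∧ avoids321 σ)) (walk? [] 0 (word σ)) (av⇔walk σ)
    (λ _ k → cong₂ (λ i l → mono (-1ℤ ℤ.^ i) l k) (inv-word σ) (lrm-word σ))

-- Closed forms by parity

-- Exposes two successors per step, so that `F` and the powers of -1 compute on even arguments.
double : ℕ → ℕ
double zero    = 0
double (suc n) = suc (suc (double n))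

double≡2* : ∀ n → 2 * n ≡ double n
double≡2* zero    = refl
double≡2* (suc n) = trans (cong suc (ℕₚ.+-suc n (n ℕ.+ 0))) (cong (suc ∘ suc) (double≡2* n))

-1^double : ∀ n → -1ℤ ℤ.^ double n ≡ 1ℤ
-1^double zero    = refl
-1^double (suc n) rewrite -1^double n = refl

-- Pascal's rule holds here by computation, which lets the coefficient identities go straight to the
-- ring solver.
binom : ℕ → ℕ → ℤ
binom n       zero    = 1ℤ
binom zero    (suc k) = 0ℤ
binom (suc n) (suc k) = binom n k ℤ.+ binom n (suc k)

binom≡C : ∀ n k → binom n k ≡ + (n C k)
binom≡C n       zero    = refl
binom≡C zero    (suc k) = refl
binom≡C (suc n) (suc k) = begin
  binom n k ℤ.+ binom n (suc k)      ≡⟨ cong₂ ℤ._+_ (binom≡C n k) (binom≡C n (suc k)) ⟩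
  + (n C k ℕ.+ n C suc k)            ≡⟨ cong +_ (nCk+nC[k+1]≡[n+1]C[k+1] n k) ⟩
  + (suc n C suc k)                  ∎
  where open ≡-Reasoning

-- Polynomials split into odd and even powers of t

interleave : (ℕ → ℤ) → (ℕ → ℤ) → Poly
interleave f g zero          = f 0
interleave f g (suc zero)    = g 0
interleave f g (suc (suc k)) = interleave (f ∘ suc) (g ∘ suc) k

-- The polynomial Σⱼ f j t²ʲ⁺¹ + Σⱼ g j t²ʲ⁺².
weave : (ℕ → ℤ) → (ℕ → ℤ) → Poly
weave f g zero    = 0ℤ
weave f g (suc k) = interleave f g k

delay : (ℕ → ℤ) → ℕ → ℤ
delay f zero    = 0ℤ
delay f (suc j) = f j

interleave-cong : ∀ {f f′ g g′} → f ≗ f′ → g ≗ g′ → interleave f g ≈ interleave f′ g′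
interleave-cong p q zero          = p 0
interleave-cong p q (suc zero)    = q 0
interleave-cong p q (suc (suc k)) = interleave-cong (p ∘ suc) (q ∘ suc) k

weave-cong : ∀ {f f′ g g′} → f ≗ f′ → g ≗ g′ → weave f g ≈ weave f′ g′
weave-cong p q zero    = refl
weave-cong p q (suc k) = interleave-cong p q k

interleave-⊕ : ∀ f g f′ g′ → interleave f g ⊕ interleave f′ g′ ≈
               interleave (λ j → f j ℤ.+ f′ j) (λ j → g j ℤ.+ g′ j)
interleave-⊕ f g f′ g′ zero          = refl
interleave-⊕ f g f′ g′ (suc zero)    = refl
interleave-⊕ f g f′ g′ (suc (suc k)) = interleave-⊕ (f ∘ suc) (g ∘ suc) (f′ ∘ suc) (g′ ∘ suc) k

weave-⊕ : ∀ {p p′ f g f′ g′} → p ≈ weave f g → p′ ≈ weave f′ g′ →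
          p ⊕ p′ ≈ weave (λ j → f j ℤ.+ f′ j) (λ j → g j ℤ.+ g′ j)
weave-⊕ p≈ p′≈ k = trans (cong₂ ℤ._+_ (p≈ k) (p′≈ k)) (sums k)
  where
  sums : ∀ {f g f′ g′} → weave f g ⊕ weave f′ g′ ≈ weave (λ j → f j ℤ.+ f′ j) (λ j → g j ℤ.+ g′ j)
  sums zero    = refl
  sums (suc k) = interleave-⊕ _ _ _ _ k

interleave-scale : ∀ c f g k → c ℤ.* interleave f g k ≡ interleave (λ j → c ℤ.* f j) (λ j → c ℤ.* g j) k
interleave-scale c f g zero          = refl
interleave-scale c f g (suc zero)    = refl
interleave-scale c f g (suc (suc k)) = interleave-scale c (f ∘ suc) (g ∘ suc) k

weave-scale : ∀ c {p f g} → p ≈ weave f g → (λ k → c ℤ.* p k) ≈ weave (λ j → c ℤ.* f j) (λ j → c ℤ.* g j)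
weave-scale c p≈ zero    = trans (cong (c ℤ.*_) (p≈ 0)) (ℤₚ.*-zeroʳ c)
weave-scale c p≈ (suc k) = trans (cong (c ℤ.*_) (p≈ (suc k))) (interleave-scale c _ _ k)

weave-⊖ : ∀ {p f g} → p ≈ weave f g → ⊖ p ≈ weave (λ j → ℤ.- f j) (λ j → ℤ.- g j)
weave-⊖ {p} p≈ k = trans (sym (ℤₚ.-1*i≡-i (p k)))
  (trans (weave-scale -1ℤ p≈ k) (weave-cong (λ _ → ℤₚ.-1*i≡-i _) (λ _ → ℤₚ.-1*i≡-i _) k))

weave-zero : weave (λ _ → 0ℤ) (λ _ → 0ℤ) ≈ 0p
weave-zero zero                = refl
weave-zero (suc zero)          = refl
weave-zero (suc (suc zero))    = refl
weave-zero (suc (suc (suc k))) = weave-zero (suc k)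

interleave-tail : ∀ f g k → interleave f g (suc k) ≡ interleave g (f ∘ suc) k
interleave-tail f g zero          = refl
interleave-tail f g (suc zero)    = refl
interleave-tail f g (suc (suc k)) = interleave-tail (f ∘ suc) (g ∘ suc) k

-- Multiplication by t exchanges the two halves: t²ʲ⁺¹ becomes t²ʲ⁺² with the same j, but t²ʲ⁺²
-- becomes t²ʲ⁺³, whose j is one larger. Hence one `delay`.
weave-shift : ∀ c {p f g} → p ≈ weave f g → shift c p ≈ weave (λ j → c ℤ.* delay g j) (λ j → c ℤ.* f j)
weave-shift c p≈ zero          = refl
weave-shift c {p} {f} {g} p≈ (suc k) = trans (weave-scale c p≈ k) (delayed k)
  where
  delayed : ∀ k → weave (λ j → c ℤ.* f j) (λ j → c ℤ.* g j) k ≡ interleave (λ j → c ℤ.* delay g j) (λ j → c ℤ.* f j) k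
  delayed zero    = sym (ℤₚ.*-zeroʳ c)
  delayed (suc k) = sym (interleave-tail _ _ k)

EvenOdd EvenEven OddEven : ℕ → ℕ → Poly
-- The names give the parities of d and r. With d equal to 2e or 2e + 1 and r equal to 2m + 1 or 2m
-- + 2, the second parameter is p = m + e. `OddEven` is a 2 × 2 determinant in adjacent binomials of
-- rows m and p + 1.
EvenOdd  m p = weave (λ j → binom m j ℤ.* binom p j) (λ j → ℤ.- (binom m (suc j) ℤ.* binom p j))
EvenEven m p = weave (λ j → ℤ.- (binom m j ℤ.* binom (suc p) j)) (λ j → binom m j ℤ.* binom (suc p) (suc j))
OddEven  m p = weave (λ _ → 0ℤ)
  (λ j → binom m j ℤ.* binom (suc p) (suc j) ℤ.- binom m (suc j) ℤ.* binom (suc p) j)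

-- Induction over the four parity classes

F-step-even : ∀ e r → F (double (suc e)) (suc r) ≈
  F (suc (double e)) (suc r) ⊕ (F (suc (double (suc e))) r ⊕ (shift 1ℤ (F (double (suc e)) r) ⊝ F (double (suc e)) r))
F-step-even e r k rewrite -1^double e = refl

F-step-odd : ∀ e r → F (suc (double e)) (suc r) ≈
  F (double e) (suc r) ⊕ (F (double (suc e)) r ⊕ (shift -1ℤ (F (suc (double e)) r) ⊝ F (suc (double e)) r))
F-step-odd e r k rewrite -1^double e = refl

zero-weave : ∀ {p} → p ≈ 0p → p ≈ weave (λ _ → 0ℤ) (λ _ → 0ℤ)
zero-weave p≈0 k = trans (p≈0 k) (sym (weave-zero k))

EvenOdd-zero : ∀ e → EvenOdd 0 e ≈ shift 1ℤ (cst 1ℤ)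
EvenOdd-zero e zero = refl
EvenOdd-zero e (suc zero) = refl
EvenOdd-zero e (suc (suc zero)) = refl
EvenOdd-zero e (suc (suc (suc k))) = weave-zero (suc k)

-- A mutual induction on r, then d. The vanishing of the odd-odd class deletes the d - 1 term for
-- even-odd, the d + 1 term for even-even and the last term for odd-even; its own vanishing is a
-- cancellation among the other three.
F-even-odd   : ∀ m e → F (double e)       (suc (double m))       ≈ EvenOdd m (m ℕ.+ e)
F-odd-odd    : ∀ m e → F (suc (double e)) (suc (double m))       ≈ 0p
F-even-even  : ∀ m e → F (double e)       (suc (suc (double m))) ≈ EvenEven m (m ℕ.+ e)
F-odd-even   : ∀ m e → F (suc (double e)) (suc (suc (double m))) ≈ OddEven m (m ℕ.+ e)

F-even-odd zero zero k = trans (x+[y-x]≡y (cst 1ℤ k) _) (sym (EvenOdd-zero 0 k))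
  where
  x+[y-x]≡y : ∀ x y → x ℤ.+ (y ℤ.- x) ≡ y
  x+[y-x]≡y = solve-∀
F-even-odd zero (suc e) k = begin
  F (double (suc e)) 1 k
    ≡⟨ F-step-even e 0 k ⟩
  F (suc (double e)) 1 k ℤ.+ (cst 1ℤ k ℤ.+ (shift 1ℤ (cst 1ℤ) k ℤ.- cst 1ℤ k))
    ≡⟨ cong (ℤ._+ (cst 1ℤ k ℤ.+ (shift 1ℤ (cst 1ℤ) k ℤ.- cst 1ℤ k))) (F-odd-odd 0 e k) ⟩
  0ℤ ℤ.+ (cst 1ℤ k ℤ.+ (shift 1ℤ (cst 1ℤ) k ℤ.- cst 1ℤ k))
    ≡⟨ 0+[x+[y-x]]≡y (cst 1ℤ k) _ ⟩
  shift 1ℤ (cst 1ℤ) k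
    ≡⟨ EvenOdd-zero (suc e) k ⟨
  EvenOdd 0 (suc e) k ∎
  where
  open ≡-Reasoning
  0+[x+[y-x]]≡y : ∀ x y → 0ℤ ℤ.+ (x ℤ.+ (y ℤ.- x)) ≡ y
  0+[x+[y-x]]≡y = solve-∀
F-even-odd (suc m) zero k = trans
  (weave-⊕ (F-odd-even m 0) (weave-⊕ (weave-shift 1ℤ (F-even-even m 0)) (weave-⊖ (F-even-even m 0))) k)
  (weave-cong odds evens k)
  where
  -- Comparison of coefficients: after Pascal's rule unfolds, only adjacent binomials x, x′ and y,
  -- y′ of two rows remain. The coefficient of t is separate because `delay` supplies a zero there.
  odds : ∀ j → _ ≡ _
  odds zero = refl
  odds (suc j) = identity (binom m j) (binom m (suc j)) (binom (suc (m ℕ.+ 0)) (suc j))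
    where
    identity : ∀ x x′ y′ → 0ℤ ℤ.+ (1ℤ ℤ.* (x ℤ.* y′) ℤ.- (ℤ.- (x′ ℤ.* y′))) ≡ (x ℤ.+ x′) ℤ.* y′
    identity = solve-∀
  evens : ∀ j → _ ≡ _
  evens j = identity (binom m j) (binom m (suc j)) (binom (suc (m ℕ.+ 0)) j) (binom (suc (m ℕ.+ 0)) (suc j))
    where
    identity : ∀ x x′ y y′ → (x ℤ.* y′ ℤ.- x′ ℤ.* y) ℤ.+ (1ℤ ℤ.* (ℤ.- (x ℤ.* y)) ℤ.- (x ℤ.* y′)) ≡
               ℤ.- ((x ℤ.+ x′) ℤ.* y)
    identity = solve-∀
F-even-odd (suc m) (suc e) k = trans (F-step-even e _ k) (trans
  (weave-⊕ (zero-weave (F-odd-odd (suc m) e)) (weave-⊕ (F-odd-even m (suc e))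
    (weave-⊕ (weave-shift 1ℤ (F-even-even m (suc e))) (weave-⊖ (F-even-even m (suc e))))) k)
  (weave-cong odds evens k))
  where
  odds : ∀ j → _ ≡ _
  odds zero = refl
  odds (suc j) = identity (binom m j) (binom m (suc j)) (binom (suc (m ℕ.+ suc e)) (suc j))
    where
    identity : ∀ x x′ y′ → 0ℤ ℤ.+ (0ℤ ℤ.+ (1ℤ ℤ.* (x ℤ.* y′) ℤ.- (ℤ.- (x′ ℤ.* y′)))) ≡ (x ℤ.+ x′) ℤ.* y′
    identity = solve-∀
  evens : ∀ j → _ ≡ _
  evens j = identity (binom m j) (binom m (suc j)) (binom (suc (m ℕ.+ suc e)) j) (binom (suc (m ℕ.+ suc e)) (suc j))
    where
    identity : ∀ x x′ y y′ →
      0ℤ ℤ.+ ((x ℤ.* y′ ℤ.- x′ ℤ.* y) ℤ.+ (1ℤ ℤ.* (ℤ.- (x ℤ.* y)) ℤ.- (x ℤ.* y′))) ≡ ℤ.- ((x ℤ.+ x′) ℤ.* y)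
    identity = solve-∀

F-odd-odd zero e k = begin
  F (suc (double e)) 1 k
    ≡⟨ F-step-odd e 0 k ⟩
  F (double e) 1 k ℤ.+ (cst 1ℤ k ℤ.+ (shift -1ℤ (cst 1ℤ) k ℤ.- cst 1ℤ k))
    ≡⟨ cong (ℤ._+ (cst 1ℤ k ℤ.+ (shift -1ℤ (cst 1ℤ) k ℤ.- cst 1ℤ k))) (trans (F-even-odd 0 e k) (EvenOdd-zero e k)) ⟩
  shift 1ℤ (cst 1ℤ) k ℤ.+ (cst 1ℤ k ℤ.+ (shift -1ℤ (cst 1ℤ) k ℤ.- cst 1ℤ k))
    ≡⟨ cancel k ⟩
  0ℤ ∎
  where
  open ≡-Reasoning
  cancel : ∀ k → shift 1ℤ (cst 1ℤ) k ℤ.+ (cst 1ℤ k ℤ.+ (shift -1ℤ (cst 1ℤ) k ℤ.- cst 1ℤ k)) ≡ 0ℤ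
  cancel zero = refl
  cancel (suc zero) = refl
  cancel (suc (suc k)) = refl
F-odd-odd (suc m) e k = trans (F-step-odd e _ k) (trans
  (weave-⊕ (F-even-odd (suc m) e) (weave-⊕
    (subst (λ p → F (double (suc e)) (suc (suc (double m))) ≈ EvenEven m p) (ℕₚ.+-suc m e) (F-even-even m (suc e)))
    (weave-⊕ (weave-shift -1ℤ (F-odd-even m e)) (weave-⊖ (F-odd-even m e)))) k)
  (trans (weave-cong odds evens k) (weave-zero k)))
  where
  odds : ∀ j → _ ≡ _
  odds zero = refl
  -- The even-odd and even-even terms add up to (x + x′) y′ - x′ (y + y′), the determinant x y′ - x′
  -- y; the factor -t moves `OddEven` into the odd powers with the opposite sign.
  odds (suc j) =
    identity (binom m j) (binom m (suc j)) (binom (suc (m ℕ.+ e)) j) (binom (suc (m ℕ.+ e)) (suc j))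
    where
    identity : ∀ x x′ y y′ → (x ℤ.+ x′) ℤ.* y′ ℤ.+ (ℤ.- (x′ ℤ.* (y ℤ.+ y′)) ℤ.+
      (-1ℤ ℤ.* (x ℤ.* y′ ℤ.- x′ ℤ.* y) ℤ.- 0ℤ)) ≡ 0ℤ
    identity = solve-∀
  evens : ∀ j → _ ≡ _
  evens j =
    identity (binom m j) (binom m (suc j)) (binom (suc (m ℕ.+ e)) j) (binom (suc (m ℕ.+ e)) (suc j))
    where
    identity : ∀ x x′ y y′ → ℤ.- ((x ℤ.+ x′) ℤ.* y) ℤ.+ (x ℤ.* (y ℤ.+ y′) ℤ.+
      (-1ℤ ℤ.* 0ℤ ℤ.- (x ℤ.* y′ ℤ.- x′ ℤ.* y))) ≡ 0ℤ
    identity = solve-∀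

F-even-even m zero = subst (λ p → F 0 (suc (suc (double m))) ≈ EvenEven m p) (sym (ℕₚ.+-identityʳ m)) λ k → trans
  (weave-⊕ (zero-weave (F-odd-odd m 0)) (weave-⊕ (weave-shift 1ℤ F-even-odd-0) (weave-⊖ F-even-odd-0)) k)
  (weave-cong odds evens k)
  where
  F-even-odd-0 : F 0 (suc (double m)) ≈ EvenOdd m m
  F-even-odd-0 = subst (λ p → F 0 (suc (double m)) ≈ EvenOdd m p) (ℕₚ.+-identityʳ m) (F-even-odd m 0)
  odds : ∀ j → _ ≡ _
  odds zero = refl
  odds (suc j) = identity (binom m (suc j)) (binom m j) (binom m (suc j))
    where
    identity : ∀ x′ y y′ → 0ℤ ℤ.+ (1ℤ ℤ.* (ℤ.- (x′ ℤ.* y)) ℤ.- x′ ℤ.* y′) ≡ ℤ.- (x′ ℤ.* (y ℤ.+ y′))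
    identity = solve-∀
  evens : ∀ j → _ ≡ _
  evens j = identity (binom m j) (binom m (suc j))
    where
    identity : ∀ x x′ → 0ℤ ℤ.+ (1ℤ ℤ.* (x ℤ.* x) ℤ.- (ℤ.- (x′ ℤ.* x))) ≡ x ℤ.* (x ℤ.+ x′)
    identity = solve-∀
F-even-even m (suc e) = subst (λ p → F (double (suc e)) (suc (suc (double m))) ≈ EvenEven m p) (sym (ℕₚ.+-suc m e)) λ k →
  trans (F-step-even e _ k) (trans
  (weave-⊕ (F-odd-even m e) (weave-⊕ (zero-weave (F-odd-odd m (suc e)))
    (weave-⊕ (weave-shift 1ℤ F-even-odd-suc) (weave-⊖ F-even-odd-suc))) k)
  (weave-cong odds evens k))
  where
  F-even-odd-suc : F (double (suc e)) (suc (double m)) ≈ EvenOdd m (suc (m ℕ.+ e))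
  F-even-odd-suc = subst (λ p → F (double (suc e)) (suc (double m)) ≈ EvenOdd m p) (ℕₚ.+-suc m e) (F-even-odd m (suc e))
  odds : ∀ j → _ ≡ _
  odds zero = refl
  odds (suc j) = identity (binom m (suc j)) (binom (suc (m ℕ.+ e)) j) (binom (suc (m ℕ.+ e)) (suc j))
    where
    identity : ∀ x′ y y′ → 0ℤ ℤ.+ (0ℤ ℤ.+ (1ℤ ℤ.* (ℤ.- (x′ ℤ.* y)) ℤ.- x′ ℤ.* y′)) ≡ ℤ.- (x′ ℤ.* (y ℤ.+ y′))
    identity = solve-∀
  evens : ∀ j → _ ≡ _
  evens j =
    identity (binom m j) (binom m (suc j)) (binom (suc (m ℕ.+ e)) j) (binom (suc (m ℕ.+ e)) (suc j))
    where
    identity : ∀ x x′ y y′ → (x ℤ.* y′ ℤ.- x′ ℤ.* y) ℤ.+ (0ℤ ℤ.+ (1ℤ ℤ.* (x ℤ.* y) ℤ.- (ℤ.- (x′ ℤ.* y)))) ≡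
                            x ℤ.* (y ℤ.+ y′)
    identity = solve-∀

F-odd-even m e k = trans (F-step-odd e _ k) (trans
  (weave-⊕ (F-even-even m e) (weave-⊕
    (subst (λ p → F (double (suc e)) (suc (double m)) ≈ EvenOdd m p) (ℕₚ.+-suc m e) (F-even-odd m (suc e)))
    (weave-⊕ (weave-shift -1ℤ (zero-weave (F-odd-odd m e))) (weave-⊖ (zero-weave (F-odd-odd m e))))) k)
  (weave-cong odds evens k))
  where
  odds : ∀ j → _ ≡ _
  odds zero = refl
  odds (suc j) = identity (binom m (suc j)) (binom (suc (m ℕ.+ e)) (suc j))
    where
    identity : ∀ x y → ℤ.- (x ℤ.* y) ℤ.+ (x ℤ.* y ℤ.+ (-1ℤ ℤ.* 0ℤ ℤ.- 0ℤ)) ≡ 0ℤ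
    identity = solve-∀
  evens : ∀ j → _ ≡ _
  evens j =
    identity (binom m j) (binom m (suc j)) (binom (suc (m ℕ.+ e)) j) (binom (suc (m ℕ.+ e)) (suc j))
    where
    identity : ∀ x x′ y y′ → x ℤ.* y′ ℤ.+ (ℤ.- (x′ ℤ.* y) ℤ.+ (-1ℤ ℤ.* 0ℤ ℤ.- 0ℤ)) ≡ x ℤ.* y′ ℤ.- x′ ℤ.* y
    identity = solve-∀

-- Comparison with `s` and `RHS`

data Parity : ℕ → Set where
  even : ∀ j → Parity (double j)
  odd  : ∀ j → Parity (suc (double j))

parity : ∀ n → Parity n
parity zero = even 0
parity (suc n) with parity n
... | even j = odd j
... | odd j  = even (suc j)

⌊double/2⌋ : ∀ n → ⌊ double n /2⌋ ≡ n
⌊double/2⌋ zero    = refl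
⌊double/2⌋ (suc n) = cong suc (⌊double/2⌋ n)

⌈double/2⌉ : ∀ n → ⌈ double n /2⌉ ≡ n
⌈double/2⌉ zero    = refl
⌈double/2⌉ (suc n) = cong suc (⌈double/2⌉ n)

interleave-even : ∀ f g j → interleave f g (double j) ≡ f j
interleave-even f g zero    = refl
interleave-even f g (suc j) = interleave-even (f ∘ suc) (g ∘ suc) j

interleave-odd : ∀ f g j → interleave f g (suc (double j)) ≡ g j
interleave-odd f g zero    = refl
interleave-odd f g (suc j) = interleave-odd (f ∘ suc) (g ∘ suc) j

binom*binom : ∀ n k n′ k′ → binom n k ℤ.* binom n′ k′ ≡ + ((n C k) ℕ.* (n′ C k′))
binom*binom n k n′ k′ = trans (cong₂ ℤ._*_ (binom≡C n k) (binom≡C n′ k′)) (sym (ℤₚ.pos-* (n C k) (n′ C k′)))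

sign-even-even : ∀ m j → -1ℤ ℤ.^ (double m ℕ.+ double j) ≡ 1ℤ
sign-even-even m j rewrite ℤₚ.^-distribˡ-+-* -1ℤ (double m) (double j) | -1^double m | -1^double j = refl

-- The exponent n + k has the parity of n - k for k ≤ n and is free of truncated subtraction, so the
-- formula makes sense for every k.
F-closed : ∀ n k → F 0 (suc n) (suc k) ≡ -1ℤ ℤ.^ (n ℕ.+ k) ℤ.* + s (suc n) (suc k)
F-closed n k with parity n | parity k
... | even m | even j
  rewrite ⌊double/2⌋ m | ⌈double/2⌉ m | ⌊double/2⌋ j | ⌈double/2⌉ j | sign-even-even m j = begin
    F 0 (suc (double m)) (suc (double j))      ≡⟨ F-even-odd m 0 (suc (double j)) ⟩
    EvenOdd m (m ℕ.+ 0) (suc (double j))       ≡⟨ cong (λ p → EvenOdd m p (suc (double j))) (ℕₚ.+-identityʳ m) ⟩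
    EvenOdd m m (suc (double j))               ≡⟨ interleave-even _ _ j ⟩
    binom m j ℤ.* binom m j                    ≡⟨ binom*binom m j m j ⟩
    + ((m C j) ℕ.* (m C j))                    ≡⟨ ℤₚ.*-identityˡ _ ⟨
    1ℤ ℤ.* + ((m C j) ℕ.* (m C j))             ∎
  where open ≡-Reasoning
... | even m | odd j
  rewrite ⌊double/2⌋ m | ⌈double/2⌉ m | ⌊double/2⌋ j | ⌈double/2⌉ j
        | ℕₚ.+-suc (double m) (double j) | sign-even-even m j = begin
    F 0 (suc (double m)) (suc (suc (double j)))  ≡⟨ F-even-odd m 0 (suc (suc (double j))) ⟩
    EvenOdd m (m ℕ.+ 0) (suc (suc (double j)))   ≡⟨ cong (λ p → EvenOdd m p (suc (suc (double j)))) (ℕₚ.+-identityʳ m) ⟩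
    EvenOdd m m (suc (suc (double j)))           ≡⟨ interleave-odd _ _ j ⟩
    ℤ.- (binom m (suc j) ℤ.* binom m j)          ≡⟨ cong -_ (ℤₚ.*-comm (binom m (suc j)) (binom m j)) ⟩
    ℤ.- (binom m j ℤ.* binom m (suc j))          ≡⟨ cong -_ (binom*binom m j m (suc j)) ⟩
    ℤ.- + ((m C j) ℕ.* (m C suc j))              ≡⟨ ℤₚ.-1*i≡-i _ ⟨
    -1ℤ ℤ.* + ((m C j) ℕ.* (m C suc j))          ∎
  where open ≡-Reasoning
... | odd m | even j
  rewrite ⌊double/2⌋ m | ⌈double/2⌉ m | ⌊double/2⌋ j | ⌈double/2⌉ j | sign-even-even m j = begin
    F 0 (suc (suc (double m))) (suc (double j))  ≡⟨ F-even-even m 0 (suc (double j)) ⟩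
    EvenEven m (m ℕ.+ 0) (suc (double j))        ≡⟨ cong (λ p → EvenEven m p (suc (double j))) (ℕₚ.+-identityʳ m) ⟩
    EvenEven m m (suc (double j))                ≡⟨ interleave-even _ _ j ⟩
    ℤ.- (binom m j ℤ.* binom (suc m) j)          ≡⟨ cong -_ (binom*binom m j (suc m) j) ⟩
    ℤ.- + ((m C j) ℕ.* (suc m C j))              ≡⟨ ℤₚ.-1*i≡-i _ ⟨
    -1ℤ ℤ.* + ((m C j) ℕ.* (suc m C j))          ∎
  where open ≡-Reasoning
... | odd m | odd j
  rewrite ⌊double/2⌋ m | ⌈double/2⌉ m | ⌊double/2⌋ j | ⌈double/2⌉ j
        | ℕₚ.+-suc (double m) (double j) | sign-even-even m j = begin
    F 0 (suc (suc (double m))) (suc (suc (double j)))  ≡⟨ F-even-even m 0 (suc (suc (double j))) ⟩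
    EvenEven m (m ℕ.+ 0) (suc (suc (double j)))        ≡⟨ cong (λ p → EvenEven m p (suc (suc (double j)))) (ℕₚ.+-identityʳ m) ⟩
    EvenEven m m (suc (suc (double j)))                ≡⟨ interleave-odd _ _ j ⟩
    binom m j ℤ.* binom (suc m) (suc j)                ≡⟨ binom*binom m j (suc m) (suc j) ⟩
    + ((m C j) ℕ.* (suc m C suc j))                    ≡⟨ ℤₚ.*-identityˡ _ ⟨
    1ℤ ℤ.* + ((m C j) ℕ.* (suc m C suc j))             ∎
  where open ≡-Reasoning

F-zero-coefficient : ∀ n → F 0 (suc n) 0 ≡ 0ℤ
F-zero-coefficient n with parity n
... | even m = F-even-odd m 0 0
... | odd m  = F-even-even m 0 0

-- If both lower indices were at most their upper indices, adding the floor and ceiling halves would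
-- give k ≤ n.
s-vanishes : ∀ n k → n < k → s (suc n) (suc k) ≡ 0
s-vanishes n k n<k with ⌊ k /2⌋ ℕ.≤? ⌊ n /2⌋ | ⌈ k /2⌉ ℕ.≤? ⌈ n /2⌉
... | no k≰n | _ rewrite k>n⇒nCk≡0 (ℕₚ.≰⇒> k≰n) = refl
... | yes _  | no k≰n rewrite k>n⇒nCk≡0 (ℕₚ.≰⇒> k≰n) = ℕₚ.*-zeroʳ (⌊ n /2⌋ C ⌊ k /2⌋)
... | yes p  | yes q = contradiction
  (subst₂ _≤_ (ℕₚ.⌊n/2⌋+⌈n/2⌉≡n k) (ℕₚ.⌊n/2⌋+⌈n/2⌉≡n n) (ℕₚ.+-mono-≤ p q)) (ℕₚ.<⇒≱ n<k)

mono-diagonal : ∀ c k → mono c k k ≡ c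
mono-diagonal c zero    = refl
mono-diagonal c (suc k) = mono-diagonal c k

mono-off : ∀ c {m k} → k ≢ m → mono c m k ≡ 0ℤ
mono-off c {zero}  {zero}  k≢m = contradiction refl k≢m
mono-off c {zero}  {suc k} k≢m = refl
mono-off c {suc m} {zero}  k≢m = refl
mono-off c {suc m} {suc k} k≢m = mono-off c (k≢m ∘ cong suc)

sumP-map : {A : Set} (f : A → Poly) → ∀ xs k → sumP (map f xs) k ≡ sumZ (map (λ x → f x k) xs)
sumP-map f []       k = refl
sumP-map f (x ∷ xs) k = cong (ℤ._+_ (f x k)) (sumP-map f xs k)

sign-∸ : ∀ {n k} → k ≤ n → -1ℤ ℤ.^ (n ∸ k) ≡ -1ℤ ℤ.^ (n ℕ.+ k)
sign-∸ {n} {k} k≤n = begin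
  -1ℤ ℤ.^ (n ∸ k)                                     ≡⟨ ℤₚ.*-identityʳ _ ⟨
  -1ℤ ℤ.^ (n ∸ k) ℤ.* 1ℤ                              ≡⟨ cong (-1ℤ ℤ.^ (n ∸ k) ℤ.*_) (sign-square k) ⟨
  -1ℤ ℤ.^ (n ∸ k) ℤ.* (-1ℤ ℤ.^ (k ℕ.+ k))             ≡⟨ ℤₚ.^-distribˡ-+-* -1ℤ (n ∸ k) (k ℕ.+ k) ⟨
  -1ℤ ℤ.^ (n ∸ k ℕ.+ (k ℕ.+ k))                       ≡⟨ cong (-1ℤ ℤ.^_) (ℕₚ.+-assoc (n ∸ k) k k) ⟨
  -1ℤ ℤ.^ (n ∸ k ℕ.+ k ℕ.+ k)                         ≡⟨ cong (λ i → -1ℤ ℤ.^ (i ℕ.+ k)) (ℕₚ.m∸n+n≡m k≤n) ⟩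
  -1ℤ ℤ.^ (n ℕ.+ k)                                   ∎
  where
  open ≡-Reasoning
  sign-square : ∀ k → -1ℤ ℤ.^ (k ℕ.+ k) ≡ 1ℤ
  sign-square k rewrite trans (cong (k ℕ.+_) (sym (ℕₚ.+-identityʳ k))) (double≡2* k) = -1^double k

RHS-∑ : ∀ n k → RHS n k ≡ ∑ n (λ i → mono (-1ℤ ℤ.^ (n ∸ suc i) ℤ.* + s n (suc i)) (suc i) k)
RHS-∑ n k = begin
  RHS n k
    ≡⟨ sumP-map _ (map suc (upTo n)) k ⟩
  sumZ (map (λ i → mono (-1ℤ ℤ.^ (n ∸ i) ℤ.* + s n i) i k) (map suc (upTo n)))
    ≡⟨ cong sumZ (Listₚ.map-∘ (upTo n)) ⟨
  sumZ (map (λ i → mono (-1ℤ ℤ.^ (n ∸ suc i) ℤ.* + s n (suc i)) (suc i) k) (upTo n))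
    ≡⟨ cong sumZ (Listₚ.map-applyUpTo id _ n) ⟩
  ∑ n (λ i → mono (-1ℤ ℤ.^ (n ∸ suc i) ℤ.* + s n (suc i)) (suc i) k) ∎
  where open ≡-Reasoning

RHS-zero-coefficient : ∀ n → RHS n 0 ≡ 0ℤ
RHS-zero-coefficient n = trans (RHS-∑ n 0) (∑-zero n (λ _ _ → refl))

RHS-closed : ∀ n k → RHS (suc n) (suc k) ≡ -1ℤ ℤ.^ (n ℕ.+ k) ℤ.* + s (suc n) (suc k)
RHS-closed n k with k ℕ.≤? n
... | yes k≤n = begin
  RHS (suc n) (suc k)
    ≡⟨ RHS-∑ (suc n) (suc k) ⟩
  ∑ (suc n) (λ i → mono (c i) (suc i) (suc k))
    ≡⟨ ∑-single (suc n) k (s≤s k≤n) (λ i _ i≢k → mono-off (c i) (i≢k ∘ sym ∘ ℕₚ.suc-injective)) ⟩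
  mono (c k) (suc k) (suc k)
    ≡⟨ mono-diagonal (c k) k ⟩
  -1ℤ ℤ.^ (n ∸ k) ℤ.* + s (suc n) (suc k)
    ≡⟨ cong (ℤ._* + s (suc n) (suc k)) (sign-∸ k≤n) ⟩
  -1ℤ ℤ.^ (n ℕ.+ k) ℤ.* + s (suc n) (suc k) ∎
  where
  open ≡-Reasoning
  c : ℕ → ℤ
  c i = -1ℤ ℤ.^ (n ∸ i) ℤ.* + s (suc n) (suc i)
... | no k≰n = begin
  RHS (suc n) (suc k)
    ≡⟨ RHS-∑ (suc n) (suc k) ⟩
  ∑ (suc n) (λ i → mono (c i) (suc i) (suc k))
    ≡⟨ ∑-zero (suc n) (λ i i≤n → mono-off (c i) {suc i} {suc k} (λ { refl → k≰n (ℕ.s≤s⁻¹ i≤n) })) ⟩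
  0ℤ
    ≡⟨ ℤₚ.*-zeroʳ (-1ℤ ℤ.^ (n ℕ.+ k)) ⟨
  -1ℤ ℤ.^ (n ℕ.+ k) ℤ.* 0ℤ
    ≡⟨ cong (λ i → -1ℤ ℤ.^ (n ℕ.+ k) ℤ.* + i) (s-vanishes n k (ℕₚ.≰⇒> k≰n)) ⟨
  -1ℤ ℤ.^ (n ℕ.+ k) ℤ.* + s (suc n) (suc k) ∎
  where
  open ≡-Reasoning
  c : ℕ → ℤ
  c i = -1ℤ ℤ.^ (n ∸ i) ℤ.* + s (suc n) (suc i)

I≈RHS : ∀ n → I-1 (suc n) ≈ RHS (suc n)
I≈RHS n zero    = trans (I≈F (suc n) 0) (trans (F-zero-coefficient n) (sym (RHS-zero-coefficient (suc n))))
I≈RHS n (suc k) = trans (I≈F (suc n) (suc k)) (trans (F-closed n k) (sym (RHS-closed n k)))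

-- Multiplication by explicit polynomials

⊛-suc : ∀ p q k → (p ⊛ q) (suc k) ≡ p 0 ℤ.* q (suc k) ℤ.+ ((p ∘ suc) ⊛ q) k
⊛-suc p q k = cong (ℤ._+_ (p 0 ℤ.* q (suc k))) (cong sumZ (begin
  map (λ i → p i ℤ.* q (suc k ∸ i)) (applyUpTo suc (suc k))    ≡⟨ Listₚ.map-applyUpTo suc _ (suc k) ⟩
  applyUpTo (λ i → p (suc i) ℤ.* q (k ∸ i)) (suc k)            ≡⟨ Listₚ.map-applyUpTo id _ (suc k) ⟨
  map (λ i → p (suc i) ℤ.* q (k ∸ i)) (upTo (suc k))           ∎))
  where open ≡-Reasoning

coefficients : List ℤ → Poly
coefficients []       k       = 0ℤ
coefficients (a ∷ as) zero    = a
coefficients (a ∷ as) (suc k) = coefficients as k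

-- Horner's form of multiplication by the polynomial with the given coefficients, which replaces the
-- convolution by scalings and shifts.
act : List ℤ → Poly → Poly
act []       q = 0p
act (a ∷ as) q = (λ k → a ℤ.* q k) ⊕ shift 1ℤ (act as q)

infixl 6 _+ᶜ_
infixl 7 _*ᶜ_

_+ᶜ_ _*ᶜ_ : List ℤ → List ℤ → List ℤ
[]       +ᶜ bs       = bs
(a ∷ as) +ᶜ []       = a ∷ as
(a ∷ as) +ᶜ (b ∷ bs) = a ℤ.+ b ∷ as +ᶜ bs
[]       *ᶜ bs = []
(a ∷ as) *ᶜ bs = map (a ℤ.*_) bs +ᶜ (0ℤ ∷ as *ᶜ bs)

-ᶜ_ : List ℤ → List ℤ
-ᶜ_ = map -_

-- A record rather than the bare equation, so that unification can read off `p` and `as` and the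
-- coefficient list is assembled along the expression.
record HasCoefficients (p : Poly) (as : List ℤ) : Set where
  constructor ⟨_⟩
  field at : p ≈ coefficients as

open HasCoefficients

⊛-act : ∀ {p as} → HasCoefficients p as → ∀ q → p ⊛ q ≈ act as q
⊛-act {as = as} ⟨ p≈ ⟩ q = go as p≈
  where
  go : ∀ {p} as → p ≈ coefficients as → p ⊛ q ≈ act as q
  go     []       p≈ zero    = cong (λ a → a ℤ.* q 0 ℤ.+ 0ℤ) (p≈ 0)
  go {p} []       p≈ (suc k) = trans (⊛-suc p q k)
    (cong₂ ℤ._+_ (cong (ℤ._* q (suc k)) (p≈ 0)) (go [] (p≈ ∘ suc) k))
  go     (a ∷ as) p≈ zero    = cong (λ a → a ℤ.* q 0 ℤ.+ 0ℤ) (p≈ 0)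
  go {p} (a ∷ as) p≈ (suc k) = trans (⊛-suc p q k)
    (cong₂ ℤ._+_ (cong (ℤ._* q (suc k)) (p≈ 0))
      (trans (go as (p≈ ∘ suc) k) (sym (ℤₚ.*-identityˡ _))))

cst-coefficients : ∀ c → HasCoefficients (cst c) (c ∷ [])
cst-coefficients c = ⟨ (λ { zero → refl ; (suc k) → refl }) ⟩

tt-coefficients : HasCoefficients tt (0ℤ ∷ 1ℤ ∷ [])
tt-coefficients = ⟨ (λ { zero → refl ; (suc zero) → refl ; (suc (suc k)) → refl }) ⟩

⊕-coefficients : ∀ {p q as bs} → HasCoefficients p as → HasCoefficients q bs → HasCoefficients (p ⊕ q) (as +ᶜ bs)
⊕-coefficients {as = as} {bs} ⟨ p≈ ⟩ ⟨ q≈ ⟩ = ⟨ (λ k → trans (cong₂ ℤ._+_ (p≈ k) (q≈ k)) (sums as bs k)) ⟩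
  where
  sums : ∀ as bs → coefficients as ⊕ coefficients bs ≈ coefficients (as +ᶜ bs)
  sums []       bs       k       = ℤₚ.+-identityˡ _
  sums (a ∷ as) []       k       = ℤₚ.+-identityʳ _
  sums (a ∷ as) (b ∷ bs) zero    = refl
  sums (a ∷ as) (b ∷ bs) (suc k) = sums as bs k

⊖-coefficients : ∀ {p as} → HasCoefficients p as → HasCoefficients (⊖ p) (-ᶜ as)
⊖-coefficients {as = as} ⟨ p≈ ⟩ = ⟨ (λ k → trans (cong -_ (p≈ k)) (negate as k)) ⟩
  where
  negate : ∀ as → ⊖ coefficients as ≈ coefficients (-ᶜ as)
  negate []       k       = refl
  negate (a ∷ as) zero    = refl
  negate (a ∷ as) (suc k) = negate as k

scale-coefficients : ∀ c bs k → c ℤ.* coefficients bs k ≡ coefficients (map (c ℤ.*_) bs) k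
scale-coefficients c []       k       = ℤₚ.*-zeroʳ c
scale-coefficients c (b ∷ bs) zero    = refl
scale-coefficients c (b ∷ bs) (suc k) = scale-coefficients c bs k

⊛-coefficients : ∀ {p q as bs} → HasCoefficients p as → HasCoefficients q bs → HasCoefficients (p ⊛ q) (as *ᶜ bs)
⊛-coefficients {p} {q} {as} {bs} hp ⟨ q≈ ⟩ = ⟨ (λ k → trans (⊛-act hp q k) (acts as k)) ⟩
  where
  acts : ∀ as → act as q ≈ coefficients (as *ᶜ bs)
  acts []       k = refl
  acts (a ∷ as) k = at (⊕-coefficients {as = map (a ℤ.*_) bs} {0ℤ ∷ as *ᶜ bs}
    ⟨ (λ k → trans (cong (a ℤ.*_) (q≈ k)) (scale-coefficients a bs k)) ⟩ ⟨ shifted ⟩) k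
    where
    shifted : shift 1ℤ (act as q) ≈ coefficients (0ℤ ∷ as *ᶜ bs)
    shifted zero    = refl
    shifted (suc k) = trans (ℤₚ.*-identityˡ _) (acts as k)

I-even : ∀ m → I-1 (suc (suc (double m))) ≈ (tt ⊝ cst 1ℤ) ⊛ I-1 (suc (double m))
I-even m k = begin
  I-1 (suc (suc (double m))) k
    ≡⟨ I≈F (suc (suc (double m))) k ⟩
  F 1 (suc (double m)) k ℤ.+ (shift 1ℤ G k ℤ.- G k)
    ≡⟨ cong (ℤ._+ (shift 1ℤ G k ℤ.- G k)) (F-odd-odd m 0 k) ⟩
  0ℤ ℤ.+ (shift 1ℤ G k ℤ.- G k)
    ≡⟨ cong₂ (λ x y → 0ℤ ℤ.+ (x ℤ.- y)) (shift-cong 1ℤ G≈I k) (G≈I k) ⟩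
  0ℤ ℤ.+ (shift 1ℤ I k ℤ.- I k)
    ≡⟨ t-1 k ⟩
  act (-1ℤ ∷ 1ℤ ∷ []) I k
    ≡⟨ ⊛-act (⊕-coefficients tt-coefficients (⊖-coefficients (cst-coefficients 1ℤ))) I k ⟨
  ((tt ⊝ cst 1ℤ) ⊛ I) k ∎
  where
  open ≡-Reasoning
  I = I-1 (suc (double m))
  G = F 0 (suc (double m))
  G≈I : G ≈ I
  G≈I k = sym (I≈F (suc (double m)) k)
  t-1 : ∀ k → 0ℤ ℤ.+ (shift 1ℤ I k ℤ.- I k) ≡ act (-1ℤ ∷ 1ℤ ∷ []) I k
  t-1 zero = identity (I 0)
    where
    identity : ∀ x → 0ℤ ℤ.+ (0ℤ ℤ.- x) ≡ -1ℤ ℤ.* x ℤ.+ 0ℤ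
    identity = solve-∀
  t-1 (suc k) = trans (identity (I (suc k)) (I k))
    (cong (λ z → -1ℤ ℤ.* I (suc k) ℤ.+ 1ℤ ℤ.* (1ℤ ℤ.* I k ℤ.+ z)) (sym (shift-0p 1ℤ k)))
    where
    identity : ∀ x y → 0ℤ ℤ.+ (1ℤ ℤ.* y ℤ.- x) ≡ -1ℤ ℤ.* x ℤ.+ 1ℤ ℤ.* (1ℤ ℤ.* y ℤ.+ 0ℤ)
    identity = solve-∀

-- The three-term recurrence

-- binomLag m j = binom m (j − 2), so that Pascal's rule and the absorption identity below
-- need no boundary cases.
binomLag : ℕ → ℕ → ℤ
binomLag m = delay (delay (binom m))

binomLag-pascal : ∀ m j → binomLag (suc m) (suc j) ≡ binomLag m j ℤ.+ binomLag m (suc j)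
binomLag-pascal m zero          = refl
binomLag-pascal m (suc zero)    = refl
binomLag-pascal m (suc (suc j)) = refl

-- This is (k+1) C(m,k+1) = (m-k) C(m,k) at k = j - 2. It follows from Pascal's rule by induction on
-- m, using the hypothesis at j and j + 1; at j = 1, where the left binomial is 1, the factor j - 1
-- is zero.
binomLag-absorb : ∀ m j → (+ j ℤ.- 1ℤ) ℤ.* binomLag m (suc j) ≡ (+ m ℤ.- + j ℤ.+ + 2) ℤ.* binomLag m j
binomLag-absorb zero zero                = refl
binomLag-absorb zero (suc zero)          = refl
binomLag-absorb zero (suc (suc zero))    = refl
binomLag-absorb zero (suc (suc (suc j))) =
  trans (ℤₚ.*-zeroʳ (+ (3 ℕ.+ j) ℤ.- 1ℤ)) (sym (ℤₚ.*-zeroʳ (0ℤ ℤ.- + (3 ℕ.+ j) ℤ.+ + 2)))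
binomLag-absorb (suc m) zero    = sym (ℤₚ.*-zeroʳ (+ suc m ℤ.- 0ℤ ℤ.+ + 2))
binomLag-absorb (suc m) (suc j) = begin
  (+ suc j ℤ.- 1ℤ) ℤ.* binomLag (suc m) (suc (suc j))
    ≡⟨ cong₂ (λ i x → (i ℤ.- 1ℤ) ℤ.* x) (suc≡1+ j) (binomLag-pascal m (suc j)) ⟩
  (1ℤ ℤ.+ + j ℤ.- 1ℤ) ℤ.* (b ℤ.+ c)
    ≡⟨ expand (+ j) b c ⟩
  ((+ j ℤ.- 1ℤ) ℤ.* b ℤ.+ b) ℤ.+ ((1ℤ ℤ.+ + j) ℤ.- 1ℤ) ℤ.* c
    ≡⟨ cong₂ (λ x y → x ℤ.+ b ℤ.+ y) (binomLag-absorb m j)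
         (trans (cong (λ i → (i ℤ.- 1ℤ) ℤ.* c) (sym (suc≡1+ j)))
           (trans (binomLag-absorb m (suc j)) (cong (λ i → (+ m ℤ.- i ℤ.+ + 2) ℤ.* b) (suc≡1+ j)))) ⟩
  ((+ m ℤ.- + j ℤ.+ + 2) ℤ.* a ℤ.+ b) ℤ.+ (+ m ℤ.- (1ℤ ℤ.+ + j) ℤ.+ + 2) ℤ.* b
    ≡⟨ collect (+ m) (+ j) a b ⟩
  (1ℤ ℤ.+ + m ℤ.- (1ℤ ℤ.+ + j) ℤ.+ + 2) ℤ.* (a ℤ.+ b)
    ≡⟨ cong₂ (λ i x → (i ℤ.- (1ℤ ℤ.+ + j) ℤ.+ + 2) ℤ.* x) (suc≡1+ m) (binomLag-pascal m j) ⟨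
  (+ suc m ℤ.- (1ℤ ℤ.+ + j) ℤ.+ + 2) ℤ.* binomLag (suc m) (suc j)
    ≡⟨ cong (λ i → (+ suc m ℤ.- i ℤ.+ + 2) ℤ.* binomLag (suc m) (suc j)) (suc≡1+ j) ⟨
  (+ suc m ℤ.- + suc j ℤ.+ + 2) ℤ.* binomLag (suc m) (suc j) ∎
  where
  open ≡-Reasoning
  a = binomLag m j
  b = binomLag m (suc j)
  c = binomLag m (suc (suc j))
  suc≡1+ : ∀ i → + suc i ≡ 1ℤ ℤ.+ + i
  suc≡1+ i = refl
  expand : ∀ x b c → (1ℤ ℤ.+ x ℤ.- 1ℤ) ℤ.* (b ℤ.+ c) ≡ ((x ℤ.- 1ℤ) ℤ.* b ℤ.+ b) ℤ.+ ((1ℤ ℤ.+ x) ℤ.- 1ℤ) ℤ.* c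
  expand = solve-∀
  collect : ∀ m x a b → ((m ℤ.- x ℤ.+ + 2) ℤ.* a ℤ.+ b) ℤ.+ (m ℤ.- (1ℤ ℤ.+ x) ℤ.+ + 2) ℤ.* b ≡
            (1ℤ ℤ.+ m ℤ.- (1ℤ ℤ.+ x) ℤ.+ + 2) ℤ.* (a ℤ.+ b)
  collect = solve-∀

-- In both identities a, b, c, d stand for binom m (x − 2), …, binom m (x + 1).
odd-identity : ∀ m x a b c →
  (x ℤ.- 1ℤ) ℤ.* b ≡ (m ℤ.- x ℤ.+ + 2) ℤ.* a →
  (1ℤ ℤ.+ x ℤ.- 1ℤ) ℤ.* c ≡ (m ℤ.- (1ℤ ℤ.+ x) ℤ.+ + 2) ℤ.* b →
  (+ 3 ℤ.+ m) ℤ.* ((a ℤ.+ b ℤ.+ (b ℤ.+ c)) ℤ.* (a ℤ.+ b ℤ.+ (b ℤ.+ c))) ≡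
  (+ 2 ℤ.* (+ 2 ℤ.+ m) ℤ.* ((b ℤ.+ c) ℤ.* (b ℤ.+ c))
    ℤ.+ -[1+ 1 ] ℤ.* (ℤ.- ((b ℤ.+ c) ℤ.* (a ℤ.+ b)))
    ℤ.+ + 2 ℤ.* (+ 2 ℤ.+ m) ℤ.* ((a ℤ.+ b) ℤ.* (a ℤ.+ b)))
  ℤ.- ((1ℤ ℤ.+ m) ℤ.* (c ℤ.* c) ℤ.+ -[1+ 1 ] ℤ.* (1ℤ ℤ.+ m) ℤ.* (b ℤ.* b) ℤ.+ (1ℤ ℤ.+ m) ℤ.* (a ℤ.* a))
-- `difference` writes the left side as the right side plus 2 (u (b + c) - v (a + b)), where u and v
-- are the differences of the sides of `p` and `q`, hence zero.
odd-identity m x a b c p q = trans (difference m x a b c)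
  (trans (cong₂ (λ u v → R ℤ.+ + 2 ℤ.* (u ℤ.* (b ℤ.+ c) ℤ.- v ℤ.* (a ℤ.+ b)))
           (ℤₚ.i≡j⇒i-j≡0 (sym p)) (ℤₚ.i≡j⇒i-j≡0 (sym q)))
         (ℤₚ.+-identityʳ R))
  where
  R = (+ 2 ℤ.* (+ 2 ℤ.+ m) ℤ.* ((b ℤ.+ c) ℤ.* (b ℤ.+ c))
    ℤ.+ -[1+ 1 ] ℤ.* (ℤ.- ((b ℤ.+ c) ℤ.* (a ℤ.+ b)))
    ℤ.+ + 2 ℤ.* (+ 2 ℤ.+ m) ℤ.* ((a ℤ.+ b) ℤ.* (a ℤ.+ b)))
    ℤ.- ((1ℤ ℤ.+ m) ℤ.* (c ℤ.* c) ℤ.+ -[1+ 1 ] ℤ.* (1ℤ ℤ.+ m) ℤ.* (b ℤ.* b) ℤ.+ (1ℤ ℤ.+ m) ℤ.* (a ℤ.* a))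
  difference : ∀ m x a b c →
    (+ 3 ℤ.+ m) ℤ.* ((a ℤ.+ b ℤ.+ (b ℤ.+ c)) ℤ.* (a ℤ.+ b ℤ.+ (b ℤ.+ c))) ≡
    (+ 2 ℤ.* (+ 2 ℤ.+ m) ℤ.* ((b ℤ.+ c) ℤ.* (b ℤ.+ c))
      ℤ.+ -[1+ 1 ] ℤ.* (ℤ.- ((b ℤ.+ c) ℤ.* (a ℤ.+ b)))
      ℤ.+ + 2 ℤ.* (+ 2 ℤ.+ m) ℤ.* ((a ℤ.+ b) ℤ.* (a ℤ.+ b)))
    ℤ.- ((1ℤ ℤ.+ m) ℤ.* (c ℤ.* c) ℤ.+ -[1+ 1 ] ℤ.* (1ℤ ℤ.+ m) ℤ.* (b ℤ.* b) ℤ.+ (1ℤ ℤ.+ m) ℤ.* (a ℤ.* a))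
    ℤ.+ + 2 ℤ.* (((m ℤ.- x ℤ.+ + 2) ℤ.* a ℤ.- (x ℤ.- 1ℤ) ℤ.* b) ℤ.* (b ℤ.+ c)
      ℤ.- ((m ℤ.- (1ℤ ℤ.+ x) ℤ.+ + 2) ℤ.* b ℤ.- (1ℤ ℤ.+ x ℤ.- 1ℤ) ℤ.* c) ℤ.* (a ℤ.+ b))
  difference = solve-∀

even-identity : ∀ m x a b c d →
  (x ℤ.- 1ℤ) ℤ.* b ≡ (m ℤ.- x ℤ.+ + 2) ℤ.* a →
  (+ 2 ℤ.+ x ℤ.- 1ℤ) ℤ.* d ≡ (m ℤ.- (+ 2 ℤ.+ x) ℤ.+ + 2) ℤ.* c →
  (+ 3 ℤ.+ m) ℤ.* (ℤ.- ((b ℤ.+ c ℤ.+ (c ℤ.+ d)) ℤ.* (a ℤ.+ b ℤ.+ (b ℤ.+ c)))) ≡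
  (+ 2 ℤ.* (+ 2 ℤ.+ m) ℤ.* (ℤ.- ((c ℤ.+ d) ℤ.* (b ℤ.+ c)))
    ℤ.+ -[1+ 1 ] ℤ.* ((b ℤ.+ c) ℤ.* (b ℤ.+ c))
    ℤ.+ + 2 ℤ.* (+ 2 ℤ.+ m) ℤ.* (ℤ.- ((b ℤ.+ c) ℤ.* (a ℤ.+ b))))
  ℤ.- ((1ℤ ℤ.+ m) ℤ.* (ℤ.- (d ℤ.* c)) ℤ.+ -[1+ 1 ] ℤ.* (1ℤ ℤ.+ m) ℤ.* (ℤ.- (c ℤ.* b)) ℤ.+ (1ℤ ℤ.+ m) ℤ.* (ℤ.- (b ℤ.* a)))
-- The same device with the absorption rule at x and x + 2: the correction is -(u (c + d) - v (a +
-- b)).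
even-identity m x a b c d p q = trans (difference m x a b c d)
  (trans (cong₂ (λ u v → R ℤ.- (u ℤ.* (c ℤ.+ d) ℤ.- v ℤ.* (a ℤ.+ b)))
           (ℤₚ.i≡j⇒i-j≡0 (sym p)) (ℤₚ.i≡j⇒i-j≡0 (sym q)))
         (ℤₚ.+-identityʳ R))
  where
  R = (+ 2 ℤ.* (+ 2 ℤ.+ m) ℤ.* (ℤ.- ((c ℤ.+ d) ℤ.* (b ℤ.+ c)))
    ℤ.+ -[1+ 1 ] ℤ.* ((b ℤ.+ c) ℤ.* (b ℤ.+ c))
    ℤ.+ + 2 ℤ.* (+ 2 ℤ.+ m) ℤ.* (ℤ.- ((b ℤ.+ c) ℤ.* (a ℤ.+ b))))
    ℤ.- ((1ℤ ℤ.+ m) ℤ.* (ℤ.- (d ℤ.* c)) ℤ.+ -[1+ 1 ] ℤ.* (1ℤ ℤ.+ m) ℤ.* (ℤ.- (c ℤ.* b)) ℤ.+ (1ℤ ℤ.+ m) ℤ.* (ℤ.- (b ℤ.* a)))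
  difference : ∀ m x a b c d →
    (+ 3 ℤ.+ m) ℤ.* (ℤ.- ((b ℤ.+ c ℤ.+ (c ℤ.+ d)) ℤ.* (a ℤ.+ b ℤ.+ (b ℤ.+ c)))) ≡
    (+ 2 ℤ.* (+ 2 ℤ.+ m) ℤ.* (ℤ.- ((c ℤ.+ d) ℤ.* (b ℤ.+ c)))
      ℤ.+ -[1+ 1 ] ℤ.* ((b ℤ.+ c) ℤ.* (b ℤ.+ c))
      ℤ.+ + 2 ℤ.* (+ 2 ℤ.+ m) ℤ.* (ℤ.- ((b ℤ.+ c) ℤ.* (a ℤ.+ b))))
    ℤ.- ((1ℤ ℤ.+ m) ℤ.* (ℤ.- (d ℤ.* c)) ℤ.+ -[1+ 1 ] ℤ.* (1ℤ ℤ.+ m) ℤ.* (ℤ.- (c ℤ.* b)) ℤ.+ (1ℤ ℤ.+ m) ℤ.* (ℤ.- (b ℤ.* a)))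
    ℤ.- (((m ℤ.- x ℤ.+ + 2) ℤ.* a ℤ.- (x ℤ.- 1ℤ) ℤ.* b) ℤ.* (c ℤ.+ d)
      ℤ.- ((m ℤ.- (+ 2 ℤ.+ x) ℤ.+ + 2) ℤ.* c ℤ.- (+ 2 ℤ.+ x ℤ.- 1ℤ) ℤ.* d) ℤ.* (a ℤ.+ b))
  difference = solve-∀

act₃-weave : ∀ a b c {q f g} → q ≈ weave f g → act (a ∷ b ∷ c ∷ []) q ≈
  weave (λ j → a ℤ.* f j ℤ.+ b ℤ.* delay g j ℤ.+ c ℤ.* delay f j)
        (λ j → a ℤ.* g j ℤ.+ b ℤ.* f j ℤ.+ c ℤ.* delay g j)
act₃-weave a b c {q} {f} {g} q≈ k = trans
  (weave-⊕ (weave-scale a q≈) (weave-shift 1ℤ (weave-⊕ (weave-scale b q≈)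
    (weave-shift 1ℤ (weave-⊕ (weave-scale c q≈) (zero-weave (shift-0p 1ℤ)))))) k)
  (weave-cong odds evens k)
  where
  odds : ∀ j → _ ≡ _
  odds zero = identity (a ℤ.* f 0) b c
    where
    identity : ∀ x b c → x ℤ.+ 1ℤ ℤ.* 0ℤ ≡ x ℤ.+ b ℤ.* 0ℤ ℤ.+ c ℤ.* 0ℤ
    identity = solve-∀
  odds (suc j) = identity (a ℤ.* f (suc j)) (b ℤ.* g j) (c ℤ.* f j)
    where
    identity : ∀ x y z → x ℤ.+ 1ℤ ℤ.* (y ℤ.+ 1ℤ ℤ.* (z ℤ.+ 0ℤ)) ≡ x ℤ.+ y ℤ.+ z
    identity = solve-∀
  evens : ∀ j → _ ≡ _
  evens zero = identity (a ℤ.* g 0) (b ℤ.* f 0) c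
    where
    identity : ∀ x y c → x ℤ.+ 1ℤ ℤ.* (y ℤ.+ 1ℤ ℤ.* 0ℤ) ≡ x ℤ.+ y ℤ.+ c ℤ.* 0ℤ
    identity = solve-∀
  evens (suc j) = identity (a ℤ.* g (suc j)) (b ℤ.* f (suc j)) (c ℤ.* g j)
    where
    identity : ∀ x y z → x ℤ.+ 1ℤ ℤ.* (y ℤ.+ 1ℤ ℤ.* (z ℤ.+ 0ℤ)) ≡ x ℤ.+ y ℤ.+ z
    identity = solve-∀

P-coefficients : ∀ c → HasCoefficients (cst (+ 2) ⊛ ((cst 1ℤ ⊕ tt ⊛ tt) ⊛ cst c ⊝ tt))
                                       (+ 2 ℤ.* c ∷ -[1+ 1 ] ∷ + 2 ℤ.* c ∷ [])
P-coefficients c = subst (HasCoefficients _)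
  (cong₂ _∷_ (constant c) (cong₂ _∷_ refl (cong (_∷ []) (quadratic c))))
  (⊛-coefficients (cst-coefficients (+ 2))
    (⊕-coefficients
      (⊛-coefficients (⊕-coefficients (cst-coefficients 1ℤ) (⊛-coefficients tt-coefficients tt-coefficients)) (cst-coefficients c))
      (⊖-coefficients tt-coefficients)))
  where
  constant : ∀ c → + 2 ℤ.* (1ℤ ℤ.* c ℤ.+ 0ℤ ℤ.+ 0ℤ) ℤ.+ 0ℤ ≡ + 2 ℤ.* c
  constant = solve-∀
  quadratic : ∀ c → + 2 ℤ.* (1ℤ ℤ.* c ℤ.+ 0ℤ) ≡ + 2 ℤ.* c
  quadratic = solve-∀

Q-coefficients : ∀ c → HasCoefficients ((cst 1ℤ ⊝ tt ⊛ tt) ⊛ (cst 1ℤ ⊝ tt ⊛ tt) ⊛ cst c)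
                                       (c ∷ 0ℤ ∷ -[1+ 1 ] ℤ.* c ∷ 0ℤ ∷ c ∷ [])
Q-coefficients c = subst (HasCoefficients _)
  (cong₂ _∷_ (unit c) (cong₂ _∷_ refl (cong₂ _∷_ (ℤₚ.+-identityʳ _) (cong₂ _∷_ refl (cong (_∷ []) (unit c))))))
  (⊛-coefficients (⊛-coefficients u u) (cst-coefficients c))
  where
  u = ⊕-coefficients (cst-coefficients 1ℤ) (⊖-coefficients (⊛-coefficients tt-coefficients tt-coefficients))
  unit : ∀ c → 1ℤ ℤ.* c ℤ.+ 0ℤ ≡ c
  unit = solve-∀

-- The multiplier c + d t² + c t⁴ is even, so the two halves do not mix and each t² is one `delay`.
act-Q-weave : ∀ c d {q f g} → q ≈ weave f g → act (c ∷ 0ℤ ∷ d ∷ 0ℤ ∷ c ∷ []) q ≈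
  weave (λ j → c ℤ.* f j ℤ.+ d ℤ.* delay f j ℤ.+ c ℤ.* delay (delay f) j)
        (λ j → c ℤ.* g j ℤ.+ d ℤ.* delay g j ℤ.+ c ℤ.* delay (delay g) j)
act-Q-weave c d {q} {f} {g} q≈ k = trans
  (weave-⊕ (weave-scale c q≈) (weave-shift 1ℤ (weave-⊕ (weave-scale 0ℤ q≈) (weave-shift 1ℤ (act₃-weave d 0ℤ c q≈)))) k)
  (weave-cong odds evens k)
  where
  first : ∀ x c d → x ℤ.+ 1ℤ ℤ.* 0ℤ ≡ x ℤ.+ d ℤ.* 0ℤ ℤ.+ c ℤ.* 0ℤ
  first = solve-∀
  second : ∀ x y u v c → x ℤ.+ 1ℤ ℤ.* (0ℤ ℤ.* u ℤ.+ 1ℤ ℤ.* (y ℤ.+ 0ℤ ℤ.* v ℤ.+ c ℤ.* 0ℤ)) ≡ x ℤ.+ y ℤ.+ c ℤ.* 0ℤ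
  second = solve-∀
  later : ∀ x y z u v → x ℤ.+ 1ℤ ℤ.* (0ℤ ℤ.* u ℤ.+ 1ℤ ℤ.* (y ℤ.+ 0ℤ ℤ.* v ℤ.+ z)) ≡ x ℤ.+ y ℤ.+ z
  later = solve-∀
  odds : ∀ j → _ ≡ _
  odds zero          = first (c ℤ.* f 0) c d
  odds (suc zero)    = second (c ℤ.* f 1) (d ℤ.* f 0) (g 0) 0ℤ c
  odds (suc (suc j)) = later (c ℤ.* f (2 ℕ.+ j)) (d ℤ.* f (suc j)) (c ℤ.* f j) (g (suc j)) (g j)
  early : ∀ x u c d → x ℤ.+ 1ℤ ℤ.* (0ℤ ℤ.* u ℤ.+ 1ℤ ℤ.* 0ℤ) ≡ x ℤ.+ d ℤ.* 0ℤ ℤ.+ c ℤ.* 0ℤ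
  early = solve-∀
  evens : ∀ j → _ ≡ _
  evens zero          = early (c ℤ.* g 0) (f 0) c d
  evens (suc zero)    = second (c ℤ.* g 1) (d ℤ.* g 0) (f 1) (f 0) c
  evens (suc (suc j)) = later (c ℤ.* g (2 ℕ.+ j)) (d ℤ.* g (suc j)) (c ℤ.* g j) (f (2 ℕ.+ j)) (f (suc j))

-- The two halves of `EvenOdd n n`, that is, the coefficients of t²ʲ⁺¹ and t²ʲ⁺² in `I-1` at 2n + 1.
diagonal offDiagonal : ℕ → ℕ → ℤ
diagonal    n j = binom n j ℤ.* binom n j
offDiagonal n j = ℤ.- (binom n (suc j) ℤ.* binom n j)

delay-diagonal : ∀ n j → delay (diagonal n) j ≡ binomLag n (1 ℕ.+ j) ℤ.* binomLag n (1 ℕ.+ j)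
delay-diagonal n zero    = refl
delay-diagonal n (suc j) = refl

-- At j = 0 the zero comes from `binomLag n 1`, although the other factor `binomLag n 2` is 1.
delay-offDiagonal : ∀ n j → delay (offDiagonal n) j ≡ ℤ.- (binomLag n (2 ℕ.+ j) ℤ.* binomLag n (1 ℕ.+ j))
delay-offDiagonal n zero    = refl
delay-offDiagonal n (suc j) = refl

delay²-diagonal : ∀ n j → delay (delay (diagonal n)) j ≡ binomLag n j ℤ.* binomLag n j
delay²-diagonal n zero          = refl
delay²-diagonal n (suc zero)    = refl
delay²-diagonal n (suc (suc j)) = refl

delay²-offDiagonal : ∀ n j → delay (delay (offDiagonal n)) j ≡ ℤ.- (binomLag n (1 ℕ.+ j) ℤ.* binomLag n j)
delay²-offDiagonal n zero          = refl
delay²-offDiagonal n (suc zero)    = refl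
delay²-offDiagonal n (suc (suc j)) = refl

-- The recurrence of the theorem at n = m + 2, whence the factors 3 + m, 2 + m and 1 + m. Two
-- applications of Pascal's rule express all three rows by row m.
EvenOdd-recurrence : ∀ m k →
  + (3 ℕ.+ m) ℤ.* EvenOdd (2 ℕ.+ m) (2 ℕ.+ m) k ≡
  act (+ 2 ℤ.* + (2 ℕ.+ m) ∷ -[1+ 1 ] ∷ + 2 ℤ.* + (2 ℕ.+ m) ∷ []) (EvenOdd (suc m) (suc m)) k
    ℤ.- act (+ suc m ∷ 0ℤ ∷ -[1+ 1 ] ℤ.* + suc m ∷ 0ℤ ∷ + suc m ∷ []) (EvenOdd m m) k
EvenOdd-recurrence m k = trans (weave-scale (+ (3 ℕ.+ m)) {EvenOdd (2 ℕ.+ m) (2 ℕ.+ m)} (λ _ → refl) k)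
  (trans (weave-cong odds evens k)
    (sym (weave-⊕ (act₃-weave (+ 2 ℤ.* + (2 ℕ.+ m)) -[1+ 1 ] (+ 2 ℤ.* + (2 ℕ.+ m)) {EvenOdd (suc m) (suc m)} (λ _ → refl))
         (weave-⊖ (act-Q-weave (+ suc m) (-[1+ 1 ] ℤ.* + suc m) {EvenOdd m m} (λ _ → refl))) k)))
  where
  pascal² : ∀ j → binomLag (2 ℕ.+ m) (2 ℕ.+ j) ≡
                  binomLag m j ℤ.+ binomLag m (1 ℕ.+ j) ℤ.+ (binomLag m (1 ℕ.+ j) ℤ.+ binomLag m (2 ℕ.+ j))
  pascal² j = trans (binomLag-pascal (suc m) (suc j)) (cong₂ ℤ._+_ (binomLag-pascal m j) (binomLag-pascal m (suc j)))
  odds : ∀ j → + (3 ℕ.+ m) ℤ.* diagonal (2 ℕ.+ m) j ≡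
    (+ 2 ℤ.* + (2 ℕ.+ m) ℤ.* diagonal (suc m) j ℤ.+ -[1+ 1 ] ℤ.* delay (offDiagonal (suc m)) j
      ℤ.+ + 2 ℤ.* + (2 ℕ.+ m) ℤ.* delay (diagonal (suc m)) j)
    ℤ.- (+ suc m ℤ.* diagonal m j ℤ.+ -[1+ 1 ] ℤ.* + suc m ℤ.* delay (diagonal m) j ℤ.+ + suc m ℤ.* delay (delay (diagonal m)) j)
  odds j rewrite delay-diagonal (suc m) j | delay-offDiagonal (suc m) j | delay-diagonal m j | delay²-diagonal m j
               | pascal² j | binomLag-pascal m j | binomLag-pascal m (suc j) =
    odd-identity (+ m) (+ j) (binomLag m j) (binomLag m (1 ℕ.+ j)) (binomLag m (2 ℕ.+ j))
      (binomLag-absorb m j) (binomLag-absorb m (1 ℕ.+ j))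
  evens : ∀ j → + (3 ℕ.+ m) ℤ.* offDiagonal (2 ℕ.+ m) j ≡
    (+ 2 ℤ.* + (2 ℕ.+ m) ℤ.* offDiagonal (suc m) j ℤ.+ -[1+ 1 ] ℤ.* diagonal (suc m) j
      ℤ.+ + 2 ℤ.* + (2 ℕ.+ m) ℤ.* delay (offDiagonal (suc m)) j)
    ℤ.- (+ suc m ℤ.* offDiagonal m j ℤ.+ -[1+ 1 ] ℤ.* + suc m ℤ.* delay (offDiagonal m) j ℤ.+ + suc m ℤ.* delay (delay (offDiagonal m)) j)
  evens j rewrite delay-offDiagonal (suc m) j | delay-offDiagonal m j | delay²-offDiagonal m j
                | pascal² (suc j) | pascal² j
                | binomLag-pascal m j | binomLag-pascal m (suc j) | binomLag-pascal m (2 ℕ.+ j) =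
    even-identity (+ m) (+ j) (binomLag m j) (binomLag m (1 ℕ.+ j)) (binomLag m (2 ℕ.+ j)) (binomLag m (3 ℕ.+ j))
      (binomLag-absorb m j) (binomLag-absorb m (2 ℕ.+ j))

EvenOdd-one : ∀ k → + 2 ℤ.* EvenOdd 1 1 k ≡ act (+ 2 ∷ -[1+ 1 ] ∷ + 2 ∷ []) (EvenOdd 0 0) k
EvenOdd-one k = trans (weave-scale (+ 2) {EvenOdd 1 1} (λ _ → refl) k)
  (trans (weave-cong odds evens k) (sym (act₃-weave (+ 2) -[1+ 1 ] (+ 2) {EvenOdd 0 0} (λ _ → refl) k)))
  where
  odds : ∀ j → + 2 ℤ.* diagonal 1 j ≡
         + 2 ℤ.* diagonal 0 j ℤ.+ -[1+ 1 ] ℤ.* delay (offDiagonal 0) j ℤ.+ + 2 ℤ.* delay (diagonal 0) j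
  odds zero          = refl
  odds (suc zero)    = refl
  odds (suc (suc j)) = refl
  evens : ∀ j → + 2 ℤ.* offDiagonal 1 j ≡
          + 2 ℤ.* offDiagonal 0 j ℤ.+ -[1+ 1 ] ℤ.* diagonal 0 j ℤ.+ + 2 ℤ.* delay (offDiagonal 0) j
  evens zero          = refl
  evens (suc zero)    = refl
  evens (suc (suc j)) = refl

I-odd : ∀ m → I-1 (suc (double m)) ≈ EvenOdd m m
I-odd m k = trans (I≈F (suc (double m)) k)
  (trans (F-even-odd m 0 k) (cong (λ p → EvenOdd m p k) (ℕₚ.+-identityʳ m)))

act-cong : ∀ as {p q} → p ≈ q → act as p ≈ act as q
act-cong []       p≈q k = refl
act-cong (a ∷ as) p≈q k = cong₂ ℤ._+_ (cong (a ℤ.*_) (p≈q k)) (shift-cong 1ℤ (act-cong as p≈q) k)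

act-zeros : ∀ n q → act (replicate n 0ℤ) q ≈ 0p
act-zeros zero    q k = refl
act-zeros (suc n) q k = trans (ℤₚ.+-identityˡ _) (trans (shift-cong 1ℤ (act-zeros n q) k) (shift-0p 1ℤ k))

cst-⊛ : ∀ c q k → (cst c ⊛ q) k ≡ c ℤ.* q k
cst-⊛ c q k = trans (⊛-act (cst-coefficients c) q k)
  (trans (cong (ℤ._+_ (c ℤ.* q k)) (shift-0p 1ℤ k)) (ℤₚ.+-identityʳ _))

-- `N` stands for 2n. Kept separate, it can be `double n` in the proof, where `N ∸ 1` and `N ∸ 3`
-- compute, and be transported to `2 * n` at the end.
OddRecurrence : ℕ → ℕ → Set
OddRecurrence n N =
  cst (+ (suc n)) ⊛ I-1 (suc N)
    ≈ cst (+ 2) ⊛ ((cst 1ℤ ⊕ tt ⊛ tt) ⊛ cst (+ n) ⊝ tt) ⊛ I-1 (N ∸ 1)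
      ⊝ (cst 1ℤ ⊝ tt ⊛ tt) ⊛ (cst 1ℤ ⊝ tt ⊛ tt) ⊛ cst (+ (n ∸ 1)) ⊛ I-1 (N ∸ 3)

odd-recurrence : ∀ n → OddRecurrence (suc n) (double (suc n))
odd-recurrence zero k = begin
  (cst (+ 2) ⊛ I-1 3) k
    ≡⟨ cst-⊛ (+ 2) (I-1 3) k ⟩
  + 2 ℤ.* I-1 3 k
    ≡⟨ cong (+ 2 ℤ.*_) (I-odd 1 k) ⟩
  + 2 ℤ.* EvenOdd 1 1 k
    ≡⟨ EvenOdd-one k ⟩
  act (+ 2 ∷ -[1+ 1 ] ∷ + 2 ∷ []) (EvenOdd 0 0) k
    ≡⟨ ℤₚ.+-identityʳ _ ⟨
  act (+ 2 ∷ -[1+ 1 ] ∷ + 2 ∷ []) (EvenOdd 0 0) k ℤ.- 0ℤ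
    ≡⟨ cong₂ ℤ._-_
         (trans (⊛-act (P-coefficients 1ℤ) (I-1 1) k) (act-cong (+ 2 ∷ -[1+ 1 ] ∷ + 2 ∷ []) (I-odd 0) k))
         -- For n = 1 the index 2n ∸ 3 truncates to 0; the factor n - 1 makes all five coefficients
         -- zero, so the value of `I-1 0` does not enter.
         (trans (⊛-act (Q-coefficients 0ℤ) (I-1 0) k) (act-zeros 5 (I-1 0) k)) ⟨
  _ ∎
  where open ≡-Reasoning
odd-recurrence (suc m) k = begin
  (cst (+ (3 ℕ.+ m)) ⊛ I-1 (suc (double (2 ℕ.+ m)))) k
    ≡⟨ cst-⊛ (+ (3 ℕ.+ m)) (I-1 (suc (double (2 ℕ.+ m)))) k ⟩
  + (3 ℕ.+ m) ℤ.* I-1 (suc (double (2 ℕ.+ m))) k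
    ≡⟨ cong (+ (3 ℕ.+ m) ℤ.*_) (I-odd (2 ℕ.+ m) k) ⟩
  + (3 ℕ.+ m) ℤ.* EvenOdd (2 ℕ.+ m) (2 ℕ.+ m) k
    ≡⟨ EvenOdd-recurrence m k ⟩
  act P (EvenOdd (suc m) (suc m)) k ℤ.- act Q (EvenOdd m m) k
    ≡⟨ cong₂ ℤ._-_
         (trans (⊛-act (P-coefficients (+ (2 ℕ.+ m))) (I-1 (suc (double (suc m)))) k) (act-cong P (I-odd (suc m)) k))
         (trans (⊛-act (Q-coefficients (+ suc m)) (I-1 (suc (double m))) k) (act-cong Q (I-odd m) k)) ⟨
  _ ∎
  where
  open ≡-Reasoning
  P = + 2 ℤ.* + (2 ℕ.+ m) ∷ -[1+ 1 ] ∷ + 2 ℤ.* + (2 ℕ.+ m) ∷ []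
  Q = + suc m ∷ 0ℤ ∷ -[1+ 1 ] ℤ.* + suc m ∷ 0ℤ ∷ + suc m ∷ []

theorem9p2 : ((n : ℕ) → 1 ≤ n → I-1 n ≈ RHS n)
    × ((n : ℕ) → 1 ≤ n → I-1 (2 * n) ≈ (tt ⊝ cst 1ℤ) ⊛ I-1 (2 * n ∸ 1))
    × ((n : ℕ) → 1 ≤ n →
    cst (+ (suc n)) ⊛ I-1 (suc (2 * n))
    ≈ cst (+ 2) ⊛ ((cst 1ℤ ⊕ tt ⊛ tt) ⊛ cst (+ n) ⊝ tt) ⊛ I-1 (2 * n ∸ 1)
    ⊝ (cst 1ℤ ⊝ tt ⊛ tt) ⊛ (cst 1ℤ ⊝ tt ⊛ tt) ⊛ cst (+ (n ∸ 1)) ⊛ I-1 (2 * n ∸ 3))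
theorem9p2 =
  (λ { (suc n) _ → I≈RHS n }) ,
  (λ { (suc n) _ → subst (λ N → I-1 N ≈ (tt ⊝ cst 1ℤ) ⊛ I-1 (N ∸ 1)) (sym (double≡2* (suc n))) (I-even n) }) ,
  (λ { (suc n) _ → subst (OddRecurrence (suc n)) (sym (double≡2* (suc n))) (odd-recurrence n) })
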